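{- For fixed $(d,b,\alpha)$ there is a constant $\beta_0 = \beta_0(d,b,\alpha)$ such that for every distance-regular graph with classical parameters $(d,b,\alpha,\beta)$ with $\beta \ge \beta_0$ the following hold for its eigenmatrix $P=(P_{ij})_{0\le i,j\le d}$: (i) $P_{ij} > 0$ for $i+j \le d$, and $P_{ij}$ has sign $(-1)^{i+j-d}$ for $i+j \ge d$. (ii) $P_{d-j+1,j} = \min \{ P_{ij} \mid 0 \le i \le d \}$ for $1\le j\le d$. (iii) If $b \ge 1$, then $|P_{i+1,j}| < |P_{ij}|$ for $0 \le i \le d-1$ and $1\le j\le d$.
   Context: For a constant $b$ define $\genfrac{[}{]}{0pt}{}{n}{m} = \genfrac{[}{]}{0pt}{}{n}{m}_b$ to be $0$ if $m<0$, $\binom{n}{m}$ if $b=1$, and $\prod_{h=0}^{m-1}\frac{b^{n-h}-1}{b^{m-h}-1}$ otherwise. A graph with classical parameters $(d,b,\alpha,\beta)$ is a distance-regular graph of diameter $d$ with intersection numbers $$b_i = \left(\genfrac{[}{]}{0pt}{}{d}{1} - \genfrac{[}{]}{0pt}{}{i}{1}\right)\left(\beta - \alpha \genfrac{[}{]}{0pt}{}{i}{1}\right),\qquad c_i = \genfrac{[}{]}{0pt}{}{i}{1}\left(1 + \alpha\genfrac{[}{]}{0pt}{}{i-1}{1}\right)\qquad (0\le i\le d).$$ Its valency is $k = b_0 = \beta\genfrac{[}{]}{0pt}{}{d}{1}$, and $a_i = k-b_i-c_i$. It is known that $b$ is an integer different from $0$ and $-1$. The eigenvalues are $\theta_i =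 \genfrac{[}{]}{0pt}{}{d-i}{1}\left(\beta - \alpha\genfrac{[}{]}{0pt}{}{i}{1}\right) - \genfrac{[}{]}{0pt}{}{i}{1}$ ($0\le i\le d$). The eigenmatrix $P$ is given by $P_{i0}=1$, $P_{i1}=\theta_i$ and $P_{i,j+1} = \left((\theta_i - a_j) P_{ij} - b_{j-1} P_{i,j-1}\right)/c_{j+1}$ for $1\le j\le d-1$; the numbers $P_{ij}$, $0\le i\le d$, are the eigenvalues of the distance-$j$ graph. -}

module Defs where

open import Data.Fin.Base using (Fin)
import Data.Fin.Properties as Fin
open import Data.Integer.Base as ℤ using (ℤ; +_; -[1+_]; 0ℤ; 1ℤ; -1ℤ)
import Data.Integer.Properties as ℤ
open import Data.List.Base using (List; foldr; length; filter; map; upTo; allFin)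
open import Data.Nat.Base as ℕ using (ℕ; zero; suc; _∸_)
import Data.Nat.Properties as ℕ
open import Data.Nat.Combinatorics using (_C_)
open import Data.Product.Base using (_×_; _,_; ∃; ∃₂; ∃-syntax)
open import Data.Rational.Base
  using (ℚ; mkℚ; 0ℚ; 1ℚ; _+_; _-_; _*_; _÷_; _/_; _≤_; ≢-nonZero)
open import Data.Rational.Properties using (_≟_)
open import Level using (0ℓ)
open import Relation.Binary.Core using (Rel)
open import Relation.Binary.Definitions using (Decidable; Symmetric)
open import Relation.Binary.PropositionalEquality using (_≡_)
open import Relation.Nullary using (¬_; Dec; yes; no; ¬?)
open import Relation.Nullary.Decidable using (_×-dec_; map′)

record Graph (n : ℕ) : Set₁ where
  field
    Adj      : Rel (Fin n) 0ℓ
    Adj?     : Decidable Adj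
    symmetric : Symmetric Adj
    loopless : ∀ x → ¬ Adj x x

module _ {n : ℕ} (G : Graph n) where
  open Graph G

  Walk : ℕ → Rel (Fin n) 0ℓ
  Walk zero    x y = x ≡ y
  Walk (suc k) x y = ∃[ z ] Adj x z × Walk k z y

  Walk? : ∀ k → Decidable (Walk k)
  Walk? zero    x y = x Fin.≟ y
  Walk? (suc k) x y = Fin.any? λ z → Adj? x z ×-dec Walk? k z y

  -- The distance between x and y is finite and equal to k.
  Dist : ℕ → Rel (Fin n) 0ℓ
  Dist k x y = Walk k x y × (∀ m → m ℕ.< k → ¬ Walk m x y)

  Dist? : ∀ k → Decidable (Dist k)
  Dist? k x y = Walk? k x y ×-dec
    map′ (λ f m m<k → f m<k) (λ f {m} m<k → f m m<k)
      (ℕ.allUpTo? (λ m → ¬? (Walk? m x y)) k)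

  -- Connectedness is part of this: every pair has a finite distance.
  HasDiameter : ℕ → Set
  HasDiameter d = (∀ x y → ∃[ k ] k ℕ.≤ d × Dist k x y) × ∃₂ (Dist d)

  -- The number of neighbours of y at distance i from x.
  neighboursAt : ℕ → Fin n → Fin n → ℕ
  neighboursAt i x y = length (filter (λ z → Dist? i x z ×-dec Adj? y z) (allFin n))

  -- The values of b# and c# at indices larger than d are irrelevant.
  record DistanceRegular (d : ℕ) : Set where
    field
      diameter : HasDiameter d
      b# c#    : ℕ → ℕ
      b#-count : ∀ i x y → i ℕ.≤ d → Dist i x y → neighboursAt (suc i) x y ≡ b# i
      c#-zero  : c# 0 ≡ 0
      c#-count : ∀ i x y → suc i ℕ.≤ d → Dist (suc i) x y → neighboursAt i x y ≡ c# (suc i)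

fromℤ : ℤ → ℚ
fromℤ z = z / 1

fromℕ : ℕ → ℚ
fromℕ m = fromℤ (+ m)

-- Total division, with p ÷₀ 0 = 0.  The convention is never reached for the
-- denominators b^(m-h) - 1 when b ∉ {-1, 0, 1}, nor for c 1, …, c d when these
-- are intersection numbers of a distance-regular graph of diameter d.
_÷₀_ : ℚ → ℚ → ℚ
p ÷₀ q with q ≟ 0ℚ
... | yes _   = 0ℚ
... | no  q≢0 = _÷_ p q {{≢-nonZero q≢0}}

product : List ℚ → ℚ
product = foldr _*_ 1ℚ

-- The Gaussian binomial [n, m] with base b.  Truncated subtraction in n ∸ h is
-- harmless: for h > n the product already contains the factor b^0 - 1 (at h = n).
gauss : ℤ → ℕ → ℤ → ℚ
gauss b n -[1+ _ ] = 0ℚ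
gauss b n (+ m) with b ℤ.≟ 1ℤ
... | yes _ = fromℕ (n C m)
... | no  _ = product (map factor (upTo m))
  where
  factor : ℕ → ℚ
  factor h = fromℤ (b ℤ.^ (n ∸ h) ℤ.- 1ℤ) ÷₀ fromℤ (b ℤ.^ (m ∸ h) ℤ.- 1ℤ)

module Classical (d : ℕ) (b : ℤ) (α β : ℚ) where

  [_] : ℕ → ℚ
  [ i ] = gauss b i 1ℤ

  bᵢ : ℕ → ℚ
  bᵢ i = ([ d ] - [ i ]) * (β - α * [ i ])

  -- At i = 0 the factor [ 0 ] vanishes, so [ i ∸ 1 ] may be truncated there.
  cᵢ : ℕ → ℚ
  cᵢ i = [ i ] * (1ℚ + α * [ i ∸ 1 ])

  aᵢ : ℕ → ℚ
  aᵢ i = bᵢ 0 - bᵢ i - cᵢ i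

  θ : ℕ → ℚ
  θ i = [ d ∸ i ] * (β - α * [ i ]) - [ i ]

  -- Only the entries with i, j ≤ d belong to the eigenmatrix.
  P : ℕ → ℕ → ℚ
  P i zero          = 1ℚ
  P i (suc zero)    = θ i
  P i (suc (suc j)) =
    ((θ i - aᵢ (suc j)) * P i (suc j) - bᵢ j * P i j) ÷₀ cᵢ (suc (suc j))

record HasClassicalParameters {n : ℕ} (G : Graph n)
                              (d : ℕ) (b : ℤ) (α β : ℚ) : Set where
  open Classical d b α β
  field
    distanceRegular : DistanceRegular G d
  open DistanceRegular distanceRegular public
  field
    b#-classical : ∀ i → i ℕ.≤ d → fromℕ (b# i) ≡ bᵢ i
    c#-classical : ∀ i → i ℕ.≤ d → fromℕ (c# i) ≡ cᵢ i

sgn : ℚ → ℤ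
sgn (mkℚ (+ zero)  _ _) = 0ℤ
sgn (mkℚ (+ suc _) _ _) = 1ℤ
sgn (mkℚ -[1+ _ ]  _ _) = -1ℤ

-- m = min { f i ∣ 0 ≤ i ≤ d }
IsMinimum : ℚ → ℕ → (ℕ → ℚ) → Set
IsMinimum m d f = (∃[ i ] i ℕ.≤ d × m ≡ f i) × (∀ i → i ℕ.≤ d → m ≤ f i)

{-# OPTIONS --safe #-}
module Submission where

-- For b ≤ -2 and d ≥ 2 the intersection number a₂ = [2] β + O(1) is negative for large β,
-- because [2] = 1 + b < 0, so there are no such graphs; d ≤ 1 is immediate.
-- For b ≥ 1 one expands the j-th column of P in the Newton basis at the nodes θ_d, θ_{d-1}, …:
--   P i j = Σ_{n ≤ d} (-1)^{j-n} b^{(j-n choose 2)} [d-n choose j-n] τ_n,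
--   τ_n = ∏_{h < n} (θ_i - θ_{d-h}) / c_{h+1}.
-- The coefficients do not depend on β, and θ_i - θ_{d-h} = ([d-i] - [h]) β + O(1) is zero for
-- h = d - i. Hence P i j is a polynomial in β of degree m = min(j, d-i), whose leading
-- coefficient comes from n = m and has sign (-1)^{j-m}. From i to i+1 either the degree drops
-- or the leading coefficient strictly decreases in absolute value. This gives (i) and (iii),
-- and (ii) follows from them.

open import Defs
open import Data.Integer.Base as ℤ using (ℤ; -[1+_]; 0ℤ; 1ℤ; -1ℤ)
import Data.Integer.Properties as ℤ
open import Data.Integer.Tactic.RingSolver using () renaming (solve-∀ to ℤ-solve-∀)
open import Data.List.Base using ([]; _∷_; length; filter; allFin)
open import Data.List.Membership.Propositional using (lose)
open import Data.List.Membership.Propositional.Properties using (∈-allFin)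
open import Data.List.Properties using (filter-some)
open import Data.Nat.Base as ℕ using (ℕ; zero; suc; s≤s; z≤n; _∸_)
open import Data.Nat.Combinatorics using (_C_; nC1≡n)
import Data.Nat.Properties as ℕ
open import Data.Product.Base using (_×_; _,_; proj₁; proj₂; ∃₂; ∃-syntax)
open import Data.Rational.Base hiding (truncate)
open import Data.Rational.Properties hiding (_≟_)
import Data.Rational.Properties as ℚ
import Data.Rational.Unnormalised.Base as ℚᵘ
import Data.Rational.Unnormalised.Properties as ℚᵘ
open import Data.Sum.Base using (_⊎_; inj₁; inj₂)
open import Level using (0ℓ)
open import Relation.Binary.PropositionalEquality hiding ([_])
open import Relation.Nullary using (¬_; Dec; yes; no; contradiction)
open import Relation.Nullary.Decidable using (dec⇒maybe)
open import Relation.Unary using (Pred; Decidable)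
open import Tactic.RingSolver using (solve-∀)
open import Tactic.RingSolver.Core.AlmostCommutativeRing using (AlmostCommutativeRing; fromCommutativeRing)

-- Graphs

-- The three-term recurrence for P by itself hides degrees and signs when b ≥ 1: once j > d - i,
-- both terms of its numerator have degree d - i + 1 in β, while the quotient has degree d - i, so
-- the leading terms cancel. In the Newton basis nothing has to cancel. The nodes are taken in
-- reversed order so that the sum for row i stops at n = d - i, and only one summand reaches the top
-- degree. The expansion is proved by checking that it satisfies the recurrence. The division by
-- c_{h+1} in τ_n gives θ_i τ_n = θ_{d-n} τ_n + c_{n+1} τ_{n+1}. Matching the coefficients of each
-- τ_n therefore eliminates i, and what remains is an identity between b-integers that holds for
-- every β.

length-filter-disjoint : ∀ {a p} {A : Set a} {P Q R : Pred A p}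
  (P? : Decidable P) (Q? : Decidable Q) (R? : Decidable R) →
  (∀ {x} → P x → R x) → (∀ {x} → Q x → R x) → (∀ {x} → P x → ¬ Q x) →
  ∀ xs → length (filter P? xs) ℕ.+ length (filter Q? xs) ℕ.≤ length (filter R? xs)
length-filter-disjoint P? Q? R? P⊆R Q⊆R P∩Q=∅ = go
  where
  go : ∀ xs → length (filter P? xs) ℕ.+ length (filter Q? xs) ℕ.≤ length (filter R? xs)
  go [] = z≤n
  go (x ∷ xs) with P? x | Q? x | R? x
  ... | yes px | yes qx | _      = contradiction qx (P∩Q=∅ px)
  ... | yes px | _      | no ¬rx = contradiction (P⊆R px) ¬rx
  ... | no _   | yes qx | no ¬rx = contradiction (Q⊆R qx) ¬rx
  ... | yes _  | no _   | yes _  = s≤s (go xs)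
  ... | no _   | yes _  | yes _  = ℕ.≤-trans (ℕ.≤-reflexive (ℕ.+-suc _ _)) (s≤s (go xs))
  ... | no _   | no _   | yes _  = ℕ.m≤n⇒m≤1+n (go xs)
  ... | no _   | no _   | no _   = go xs

module _ {n : ℕ} {G : Graph n} where
  open Graph G

  Walk-snoc : ∀ {k x y z} → Walk G k x y → Adj y z → Walk G (suc k) x z
  Walk-snoc {zero}  refl          yz = _ , yz , refl
  Walk-snoc {suc k} (w , xw , wy) yz = w , xw , Walk-snoc wy yz

  Walk-sym : ∀ {k x y} → Walk G k x y → Walk G k y x
  Walk-sym {zero}  refl          = refl
  Walk-sym {suc k} (w , xw , wy) = Walk-snoc (Walk-sym wy) (symmetric xw)

  Dist-sym : ∀ {k x y} → Dist G k x y → Dist G k y x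
  Dist-sym (w , shortest) = Walk-sym w , λ m m<k w′ → shortest m m<k (Walk-sym w′)

  Dist-unique : ∀ {k l x y} → k ℕ.< l → Dist G k x y → ¬ Dist G l x y
  Dist-unique k<l (w , _) (_ , shortest) = shortest _ k<l w

  Dist-pred : ∀ {k x y} → Dist G (suc k) x y → ∃[ z ] Adj x z × Dist G k z y
  Dist-pred ((z , xz , zy) , shortest) =
    z , xz , zy , λ m m<k w → shortest (suc m) (s≤s m<k) (z , xz , w)

  -- Each step drops the first vertex of a geodesic and keeps its last one.
  Dist-shorten : ∀ {k l} → k ℕ.≤′ l → ∃₂ (Dist G l) → ∃₂ (Dist G k)
  Dist-shorten ℕ.≤′-refl       xy          = xy
  Dist-shorten (ℕ.≤′-step k≤l) (x , y , D) with z , _ , D′ ← Dist-pred D =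
    Dist-shorten k≤l (z , y , D′)

  Dist-zero : ∀ x → Dist G 0 x x
  Dist-zero x = refl , λ _ ()

  Adj⇒Dist-one : ∀ {x y} → Adj x y → Dist G 1 x y
  Adj⇒Dist-one {x} {y} xy = (y , xy , refl) , shortest
    where
    shortest : ∀ m → m ℕ.< 1 → ¬ Walk G m x y
    shortest zero _ refl = loopless x xy
    shortest (suc _) (s≤s ()) _

  module _ {d : ℕ} (regular : DistanceRegular G d) where
    open DistanceRegular regular

    distance-attained : ∀ {k} → k ℕ.≤ d → ∃₂ (Dist G k)
    distance-attained k≤d with _ , attained ← diameter = Dist-shorten (ℕ.≤⇒≤′ k≤d) attained

    -- The vertex after x on a geodesic from x to y is a neighbour of x one step closer to y. The
    -- count is therefore taken at x with base point y, which is why the distances are reversed.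
    c#-positive : ∀ {k} → k ℕ.< d → 0 ℕ.< c# (suc k)
    c#-positive k<d with x , y , D ← distance-attained k<d with z , xz , D′ ← Dist-pred D =
      subst (0 ℕ.<_) (c#-count _ y x k<d (Dist-sym D))
        (filter-some _ (lose (∈-allFin z) (Dist-sym D′ , xz)))

    -- Neighbours of y at distances k + 2 and k from x form disjoint sets of neighbours. Counted
    -- from y itself, every neighbour is at distance 1, so `b# 0` is the valency. This yields a_i ≥
    -- 0 without counting a_i.
    b#+c#≤valency : ∀ {k} → k ℕ.< d → b# (suc k) ℕ.+ c# (suc k) ℕ.≤ b# 0
    b#+c#≤valency {k} k<d with x , y , D ← distance-attained k<d = begin
      b# (suc k) ℕ.+ c# (suc k)
        ≡⟨ cong₂ ℕ._+_ (b#-count (suc k) x y k<d D) (c#-count k x y k<d D) ⟨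
      neighboursAt G (suc (suc k)) x y ℕ.+ neighboursAt G k x y
        ≤⟨ length-filter-disjoint _ _ _ (λ (_ , yz) → Adj⇒Dist-one yz , yz)
             (λ (_ , yz) → Adj⇒Dist-one yz , yz)
             (λ (D₁ , _) (D₂ , _) → Dist-unique (ℕ.m≤n⇒m≤1+n (ℕ.n<1+n k)) D₂ D₁) (allFin n) ⟩
      neighboursAt G 1 y y
        ≡⟨ b#-count 0 y y z≤n (Dist-zero y) ⟩
      b# 0 ∎
      where open ℕ.≤-Reasoning

-- Rationals and b-integers

ℚ-ring : AlmostCommutativeRing 0ℓ 0ℓ
ℚ-ring = fromCommutativeRing +-*-commutativeRing (λ x → dec⇒maybe (0ℚ ℚ.≟ x))

*-pos : ∀ {p q} → 0ℚ < p → 0ℚ < q → 0ℚ < p * q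
*-pos {p} {q} 0<p 0<q =
  positive⁻¹ (p * q) {{pos*pos⇒pos p {{positive 0<p}} q {{positive 0<q}}}}

p<q⇒0<q-p : ∀ {p q} → p < q → 0ℚ < q - p
p<q⇒0<q-p {p} {q} p<q = subst (_< q - p) (+-inverseʳ p) (+-monoˡ-< (- p) p<q)

0<q-p⇒p<q : ∀ {p q} → 0ℚ < q - p → p < q
0<q-p⇒p<q {p} {q} 0<q-p =
  subst₂ _<_ (+-identityʳ p) (cancel p q) (+-monoʳ-< p 0<q-p)
  where
  cancel : ∀ p q → p + (q - p) ≡ q
  cancel = solve-∀ ℚ-ring

pos⇒≢0 : ∀ {p} → 0ℚ < p → p ≢ 0ℚ
pos⇒≢0 0<p refl = <-irrefl refl 0<p

÷₀-inverse : ∀ {q} → q ≢ 0ℚ → q * (1ℚ ÷₀ q) ≡ 1ℚ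
÷₀-inverse {q} q≢0 with q ℚ.≟ 0ℚ
... | yes q≡0 = contradiction q≡0 q≢0
... | no  q≢0 = trans (cong (q *_) (*-identityˡ _)) (*-inverseʳ q {{≢-nonZero q≢0}})

-- At q = 0 both sides vanish by the convention for `_÷₀_`, so quotients become products before any
-- denominator is known to be nonzero.
÷₀-as-* : ∀ p q → p ÷₀ q ≡ p * (1ℚ ÷₀ q)
÷₀-as-* p q with q ℚ.≟ 0ℚ
... | yes _   = sym (*-zeroʳ p)
... | no  q≢0 = cong (p *_) (sym (*-identityˡ _))

÷₀-positive : ∀ {q} → 0ℚ < q → 0ℚ < 1ℚ ÷₀ q
÷₀-positive {q} 0<q with q ℚ.≟ 0ℚ
... | yes q≡0 = contradiction q≡0 (pos⇒≢0 0<q)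
... | no  q≢0 = subst (0ℚ <_) (sym (*-identityˡ 1/q))
  (positive⁻¹ 1/q {{1/pos⇒pos q {{positive 0<q}}}})
  where 1/q = (1/ q) {{≢-nonZero q≢0}}

÷₀-unique : ∀ {p q r} → q ≢ 0ℚ → q * r ≡ p → p ÷₀ q ≡ r
÷₀-unique {q = q} {r} q≢0 refl = begin
  (q * r) ÷₀ q          ≡⟨ ÷₀-as-* (q * r) q ⟩
  q * r * (1ℚ ÷₀ q)     ≡⟨ swap q r (1ℚ ÷₀ q) ⟩
  q * (1ℚ ÷₀ q) * r     ≡⟨ cong (_* r) (÷₀-inverse q≢0) ⟩
  1ℚ * r                ≡⟨ *-identityˡ r ⟩
  r                     ∎
  where
  open ≡-Reasoning
  swap : ∀ q r s → q * r * s ≡ q * s * r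
  swap = solve-∀ ℚ-ring

fromℤ-+ : ∀ m n → fromℤ (m ℤ.+ n) ≡ fromℤ m + fromℤ n
fromℤ-+ m n = toℚᵘ-injective (begin
  toℚᵘ (fromℤ (m ℤ.+ n))               ≈⟨ toℚᵘ-fromℚᵘ m+n ⟩
  m+n                                  ≈⟨ ℚᵘ.*≡* (eq m n) ⟩
  ℚᵘ.mkℚᵘ m 0 ℚᵘ.+ ℚᵘ.mkℚᵘ n 0
    ≈⟨ ℚᵘ.+-cong (toℚᵘ-fromℚᵘ (ℚᵘ.mkℚᵘ m 0)) (toℚᵘ-fromℚᵘ (ℚᵘ.mkℚᵘ n 0)) ⟨
  toℚᵘ (fromℤ m) ℚᵘ.+ toℚᵘ (fromℤ n)   ≈⟨ toℚᵘ-homo-+ (fromℤ m) (fromℤ n) ⟨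
  toℚᵘ (fromℤ m + fromℤ n)             ∎)
  where
  open ℚᵘ.≃-Reasoning
  m+n = ℚᵘ.mkℚᵘ (m ℤ.+ n) 0
  eq : ∀ m n → (m ℤ.+ n) ℤ.* 1ℤ ≡ (m ℤ.* 1ℤ ℤ.+ n ℤ.* 1ℤ) ℤ.* 1ℤ
  eq = ℤ-solve-∀

fromℤ-* : ∀ m n → fromℤ (m ℤ.* n) ≡ fromℤ m * fromℤ n
fromℤ-* m n = toℚᵘ-injective (begin
  toℚᵘ (fromℤ (m ℤ.* n))               ≈⟨ toℚᵘ-fromℚᵘ (ℚᵘ.mkℚᵘ (m ℤ.* n) 0) ⟩
  ℚᵘ.mkℚᵘ m 0 ℚᵘ.* ℚᵘ.mkℚᵘ n 0
    ≈⟨ ℚᵘ.*-cong (toℚᵘ-fromℚᵘ (ℚᵘ.mkℚᵘ m 0)) (toℚᵘ-fromℚᵘ (ℚᵘ.mkℚᵘ n 0)) ⟨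
  toℚᵘ (fromℤ m) ℚᵘ.* toℚᵘ (fromℤ n)   ≈⟨ toℚᵘ-homo-* (fromℤ m) (fromℤ n) ⟨
  toℚᵘ (fromℤ m * fromℤ n)             ∎)
  where open ℚᵘ.≃-Reasoning

fromℤ-injective : ∀ {m n} → fromℤ m ≡ fromℤ n → m ≡ n
fromℤ-injective {m} {n} eq with ℚᵘ.*≡* h ← fromℚᵘ-injective {ℚᵘ.mkℚᵘ m 0} {ℚᵘ.mkℚᵘ n 0} eq =
  trans (sym (ℤ.*-identityʳ m)) (trans h (ℤ.*-identityʳ n))

fromℤ-mono-≤ : ∀ {m n} → m ℤ.≤ n → fromℤ m ≤ fromℤ n
fromℤ-mono-≤ {m} {n} m≤n = toℚᵘ-cancel-≤ (begin
  toℚᵘ (fromℤ m) ≃⟨ toℚᵘ-fromℚᵘ (ℚᵘ.mkℚᵘ m 0) ⟩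
  ℚᵘ.mkℚᵘ m 0    ≤⟨ ℚᵘ.*≤* (ℤ.*-monoʳ-≤-nonNeg 1ℤ m≤n) ⟩
  ℚᵘ.mkℚᵘ n 0    ≃⟨ toℚᵘ-fromℚᵘ (ℚᵘ.mkℚᵘ n 0) ⟨
  toℚᵘ (fromℤ n) ∎)
  where open ℚᵘ.≤-Reasoning

gauss-zero : ∀ b → gauss b 0 1ℤ ≡ 0ℚ
gauss-zero b with b ℤ.≟ 1ℤ
... | yes _ = refl
... | no  _ = cong (_* 1ℚ) (trans (÷₀-as-* 0ℚ e) (*-zeroˡ (1ℚ ÷₀ e)))
  where e = fromℤ (b ℤ.^ 1 ℤ.- 1ℤ)

-- For b ≠ 1 this is b^(k+1) - 1 = (b - 1) + b (b^k - 1) divided by b - 1. Together with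
-- `gauss-zero` it describes the b-integers uniformly, so the case b = 1 is not separated again.
gauss-suc : ∀ b k → gauss b (suc k) 1ℤ ≡ 1ℚ + fromℤ b * gauss b k 1ℤ
gauss-suc b k with b ℤ.≟ 1ℤ
... | yes refl = begin
  fromℕ (suc k C 1)           ≡⟨ cong fromℕ (nC1≡n (suc k)) ⟩
  fromℤ (ℤ.+ suc k)             ≡⟨ fromℤ-+ 1ℤ (ℤ.+ k) ⟩
  1ℚ + fromℕ k                ≡⟨ cong (λ n → 1ℚ + fromℕ n) (nC1≡n k) ⟨
  1ℚ + fromℕ (k C 1)          ≡⟨ cong (1ℚ +_) (*-identityˡ (fromℕ (k C 1))) ⟨
  1ℚ + 1ℚ * fromℕ (k C 1)     ∎
  where open ≡-Reasoning
... | no  b≢1 = begin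
  fromℤ (b ℤ.^ suc k ℤ.- 1ℤ) ÷₀ e * 1ℚ
    ≡⟨ cong (_* 1ℚ) (÷₀-as-* _ e) ⟩
  fromℤ (b ℤ.^ suc k ℤ.- 1ℤ) * r * 1ℚ
    ≡⟨ cong (λ z → fromℤ z * r * 1ℚ) (telescope b (b ℤ.^ k)) ⟩
  fromℤ ((b ℤ.^ 1 ℤ.- 1ℤ) ℤ.+ b ℤ.* (b ℤ.^ k ℤ.- 1ℤ)) * r * 1ℚ
    ≡⟨ cong (λ z → z * r * 1ℚ) (trans (fromℤ-+ (b ℤ.^ 1 ℤ.- 1ℤ) (b ℤ.* g)) (cong (e +_) (fromℤ-* b g))) ⟩
  (e + fromℤ b * fromℤ g) * r * 1ℚ
    ≡⟨ distribute e (fromℤ b) (fromℤ g) r ⟩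
  e * r + fromℤ b * (fromℤ g * r * 1ℚ)
    ≡⟨ cong₂ (λ s t → s + fromℤ b * (t * 1ℚ)) (÷₀-inverse e≢0) (sym (÷₀-as-* (fromℤ g) e)) ⟩
  1ℚ + fromℤ b * (fromℤ g ÷₀ e * 1ℚ) ∎
  where
  open ≡-Reasoning
  e = fromℤ (b ℤ.^ 1 ℤ.- 1ℤ)
  r = 1ℚ ÷₀ e
  g = b ℤ.^ k ℤ.- 1ℤ
  e≢0 : e ≢ 0ℚ
  e≢0 e≡0 = b≢1 (trans (sym (ℤ.*-identityʳ b)) (ℤ.i-j≡0⇒i≡j _ _ (fromℤ-injective e≡0)))
  telescope : ∀ b c → b ℤ.* c ℤ.- 1ℤ ≡ (b ℤ.* 1ℤ ℤ.- 1ℤ) ℤ.+ b ℤ.* (c ℤ.- 1ℤ)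
  telescope = ℤ-solve-∀
  distribute : ∀ e q g r → (e + q * g) * r * 1ℚ ≡ e * r + q * (g * r * 1ℚ)
  distribute = solve-∀ ℚ-ring

*-cancelˡ : ∀ {p q r} → p ≢ 0ℚ → p * q ≡ p * r → q ≡ r
*-cancelˡ p≢0 pq≡pr = trans (sym (÷₀-unique p≢0 refl)) (÷₀-unique p≢0 (sym pq≡pr))

-- Polynomials in β for large β

Eventually : (ℚ → Set) → Set
Eventually Q = ∃[ β₀ ] ∀ β → β₀ ≤ β → Q β

Eventually-map : ∀ {Q R : ℚ → Set} → (∀ {β} → Q β → R β) → Eventually Q → Eventually R
Eventually-map f (β₀ , Qβ) = β₀ , λ β β₀≤β → f (Qβ β β₀≤β)

Eventually-× : ∀ {Q R : ℚ → Set} → Eventually Q → Eventually R → Eventually (λ β → Q β × R β)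
Eventually-× (β₁ , Qβ) (β₂ , Rβ) = β₁ ⊔ β₂ , λ β β₀≤β →
  Qβ β (≤-trans (p≤p⊔q β₁ β₂) β₀≤β) , Rβ β (≤-trans (p≤q⊔p β₁ β₂) β₀≤β)

Eventually-∀< : ∀ {Q : ℕ → ℚ → Set} n → (∀ i → i ℕ.< n → Eventually (Q i)) →
  Eventually (λ β → ∀ i → i ℕ.< n → Q i β)
Eventually-∀< zero    _ = 0ℚ , λ _ _ _ ()
Eventually-∀< {Q} (suc n) e = Eventually-map extend
  (Eventually-× (Eventually-∀< n (λ i i<n → e i (ℕ.m≤n⇒m≤1+n i<n))) (e n ℕ.≤-refl))
  where
  extend : ∀ {β} → (∀ i → i ℕ.< n → Q i β) × Q n β → ∀ i → i ℕ.< suc n → Q i β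
  extend (below , top) i (s≤s i≤n) with ℕ.m≤n⇒m<n∨m≡n i≤n
  ... | inj₁ i<n  = below i i<n
  ... | inj₂ refl = top

-- f is a polynomial of degree at most m, and L is its coefficient at β ^ m.
data Leading : ℕ → ℚ → (ℚ → ℚ) → Set where
  constant : ∀ {f L} → (∀ β → f β ≡ L) → Leading 0 L f
  horner   : ∀ {m L f g r} → Leading m L g → (∀ β → f β ≡ β * g β + r) → Leading (suc m) L f

Leading-cong : ∀ {m L f g} → (∀ β → f β ≡ g β) → Leading m L g → Leading m L f
Leading-cong f≗g (constant eq)      = constant λ β → trans (f≗g β) (eq β)
Leading-cong f≗g (horner lead eq)   = horner lead λ β → trans (f≗g β) (eq β)

Leading-+ : ∀ {m L M f g} → Leading m L f → Leading m M g → Leading m (L + M) (λ β → f β + g β)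
Leading-+ (constant eq) (constant eq′) = constant λ β → cong₂ _+_ (eq β) (eq′ β)
Leading-+ (horner {g = g} {r} lead eq) (horner {g = g′} {r′} lead′ eq′) =
  horner (Leading-+ lead lead′) λ β → trans (cong₂ _+_ (eq β) (eq′ β)) (expand β (g β) (g′ β) r r′)
  where
  expand : ∀ β g g′ r r′ → (β * g + r) + (β * g′ + r′) ≡ β * (g + g′) + (r + r′)
  expand = solve-∀ ℚ-ring

Leading-* : ∀ {m L f} p → Leading m L f → Leading m (p * L) (λ β → p * f β)
Leading-* p (constant eq) = constant λ β → cong (p *_) (eq β)
Leading-* p (horner {g = g} {r} lead eq) =
  horner (Leading-* p lead) λ β → trans (cong (p *_) (eq β)) (expand p β (g β) r)
  where
  expand : ∀ p β g r → p * (β * g + r) ≡ β * (p * g) + p * r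
  expand = solve-∀ ℚ-ring

Leading-raise : ∀ {m L f} → Leading m L f → Leading (suc m) 0ℚ f
Leading-raise (constant {L = L} eq) = horner (constant {λ _ → 0ℚ} λ _ → refl) λ β → trans (eq β) (expand β L)
  where
  expand : ∀ β L → L ≡ β * 0ℚ + L
  expand = solve-∀ ℚ-ring
Leading-raise (horner lead eq) = horner (Leading-raise lead) eq

Leading-affine : ∀ {m L f} p r → Leading m L f → Leading (suc m) (p * L) (λ β → (p * β + r) * f β)
Leading-affine {L = L} {f} p r lead = subst (λ M → Leading _ M _) (+-identityʳ (p * L))
  (Leading-cong (λ β → expand p β r (f β))
    (Leading-+ (horner {r = 0ℚ} (Leading-* p lead) λ _ → refl) (Leading-raise (Leading-* r lead))))
  where
  expand : ∀ p β r f → (p * β + r) * f ≡ (β * (p * f) + 0ℚ) + r * f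
  expand = solve-∀ ℚ-ring

-- Write f = β g + r with g ≥ L eventually. For β ≥ 0 this gives f ≥ β L + r, and `β₂` is the value
-- of β where β L + r equals L. Carrying the bound L, rather than mere positivity, is what lets the
-- induction pass through the remainders r.
Leading⇒≥ : ∀ {m L f} → 0ℚ < L → Leading m L f → Eventually (λ β → L ≤ f β)
Leading⇒≥ 0<L (constant eq) = 0ℚ , λ β _ → ≤-reflexive (sym (eq β))
Leading⇒≥ {L = L} {f} 0<L (horner {g = g} {r} lead eq) with β₁ , L≤g ← Leading⇒≥ 0<L lead =
  β₁ ⊔ (0ℚ ⊔ β₂) , bound
  where
  β₂ = (L - r) * (1ℚ ÷₀ L)
  bound : ∀ β → β₁ ⊔ (0ℚ ⊔ β₂) ≤ β → L ≤ f β
  bound β β₀≤β = begin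
    L                                  ≡⟨ expand L r ⟩
    (L - r) * 1ℚ + r                   ≡⟨ cong (λ t → (L - r) * t + r) (÷₀-inverse (pos⇒≢0 0<L)) ⟨
    (L - r) * (L * (1ℚ ÷₀ L)) + r      ≡⟨ cong (_+ r) (swap (L - r) L (1ℚ ÷₀ L)) ⟩
    β₂ * L + r                         ≤⟨ +-monoˡ-≤ r (*-monoʳ-≤-nonNeg L {{nonNegative (<⇒≤ 0<L)}} β₂≤β) ⟩
    β * L + r                          ≤⟨ +-monoˡ-≤ r (*-monoˡ-≤-nonNeg β {{nonNegative 0≤β}} (L≤g β β₁≤β)) ⟩
    β * g β + r                        ≡⟨ eq β ⟨
    f β                                ∎
    where
    open ≤-Reasoning
    β₁≤β : β₁ ≤ β
    β₁≤β = ≤-trans (p≤p⊔q β₁ (0ℚ ⊔ β₂)) β₀≤β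
    0⊔β₂≤β : 0ℚ ⊔ β₂ ≤ β
    0⊔β₂≤β = ≤-trans (p≤q⊔p β₁ (0ℚ ⊔ β₂)) β₀≤β
    0≤β : 0ℚ ≤ β
    0≤β = ≤-trans (p≤p⊔q 0ℚ β₂) 0⊔β₂≤β
    β₂≤β : β₂ ≤ β
    β₂≤β = ≤-trans (p≤q⊔p 0ℚ β₂) 0⊔β₂≤β
    expand : ∀ L r → L ≡ (L - r) * 1ℚ + r
    expand = solve-∀ ℚ-ring
    swap : ∀ s t u → s * (t * u) ≡ s * u * t
    swap = solve-∀ ℚ-ring

Leading⇒positive : ∀ {m L f} → 0ℚ < L → Leading m L f → Eventually (λ β → 0ℚ < f β)
Leading⇒positive 0<L lead = Eventually-map (<-≤-trans 0<L) (Leading⇒≥ 0<L lead)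

-- Signs and absolute values as positivity statements

ε : ℕ → ℚ
ε zero    = 1ℚ
ε (suc k) = - ε k

sgn-neg : ∀ p → sgn (- p) ≡ ℤ.- sgn p
sgn-neg (mkℚ (ℤ.+ zero)  _ _) = refl
sgn-neg (mkℚ (ℤ.+ suc _) _ _) = refl
sgn-neg (mkℚ -[1+ _ ]    _ _) = refl

sgn-positive : ∀ {p} → 0ℚ < p → sgn p ≡ 1ℤ
sgn-positive {mkℚ (ℤ.+ zero)  _ _} (*<* (ℤ.+<+ ()))
sgn-positive {mkℚ (ℤ.+ suc _) _ _} _ = refl
sgn-positive {mkℚ -[1+ _ ]    _ _} (*<* ())

sgn-alternating : ∀ k {p} → 0ℚ < ε k * p → sgn p ≡ -1ℤ ℤ.^ k
sgn-alternating zero    {p} pos = sgn-positive (subst (0ℚ <_) (*-identityˡ p) pos)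
sgn-alternating (suc k) {p} pos = begin
  sgn p                ≡⟨ ℤ.neg-involutive (sgn p) ⟨
  ℤ.- (ℤ.- sgn p)      ≡⟨ cong ℤ.-_ (sgn-neg p) ⟨
  ℤ.- sgn (- p)        ≡⟨ cong ℤ.-_ (sgn-alternating k (subst (0ℚ <_) (move (ε k) p) pos)) ⟩
  ℤ.- (-1ℤ ℤ.^ k)      ≡⟨ ℤ.-1*i≡-i (-1ℤ ℤ.^ k) ⟨
  -1ℤ ℤ.^ suc k        ∎
  where
  open ≡-Reasoning
  move : ∀ e p → - e * p ≡ e * - p
  move = solve-∀ ℚ-ring

p≤∣p∣ : ∀ p → p ≤ ∣ p ∣
p≤∣p∣ p with ≤-total 0ℚ p
... | inj₁ 0≤p = ≤-reflexive (sym (0≤p⇒∣p∣≡p 0≤p))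
... | inj₂ p≤0 = ≤-trans p≤0 (0≤∣p∣ p)

-∣p∣≤p : ∀ p → - ∣ p ∣ ≤ p
-∣p∣≤p p = subst₂ _≤_ (cong -_ (∣-p∣≡∣p∣ p)) (expand p) (neg-antimono-≤ (p≤∣p∣ (- p)))
  where
  expand : ∀ p → - - p ≡ p
  expand = solve-∀ ℚ-ring

∣ε∣≡1 : ∀ k → ∣ ε k ∣ ≡ 1ℚ
∣ε∣≡1 zero    = refl
∣ε∣≡1 (suc k) = trans (∣-p∣≡∣p∣ (ε k)) (∣ε∣≡1 k)

-- The hypotheses bound both r and - r by ε k * p, which is at most ∣ p ∣. They are linear in p and
-- r, hence positivity statements about polynomials in β when p and r are such; the explicit factors
-- 1 and - 1 make them two instances of one lemma with a sign parameter.
∣∣<∣∣-ε : ∀ k {p r} → 0ℚ < ε k * p + 1ℚ * r → 0ℚ < ε k * p + (- 1ℚ) * r → ∣ r ∣ < ∣ p ∣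
∣∣<∣∣-ε k {p} {r} sum-positive diff-positive = <-≤-trans ∣r∣<εp εp≤∣p∣
  where
  εp≤∣p∣ : ε k * p ≤ ∣ p ∣
  εp≤∣p∣ = subst (ε k * p ≤_)
    (trans (∣p*q∣≡∣p∣*∣q∣ (ε k) p) (trans (cong (_* ∣ p ∣) (∣ε∣≡1 k)) (*-identityˡ ∣ p ∣)))
    (p≤∣p∣ (ε k * p))
  expand : ∀ s r → s + 1ℚ * r ≡ s - - r
  expand = solve-∀ ℚ-ring
  expand′ : ∀ s r → s + (- 1ℚ) * r ≡ s - r
  expand′ = solve-∀ ℚ-ring
  ∣r∣<εp : ∣ r ∣ < ε k * p
  ∣r∣<εp with ∣p∣≡p∨∣p∣≡-p r
  ... | inj₁ eq = subst (_< ε k * p) (sym eq)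
    (0<q-p⇒p<q (subst (0ℚ <_) (expand′ (ε k * p) r) diff-positive))
  ... | inj₂ eq = subst (_< ε k * p) (sym eq)
    (0<q-p⇒p<q (subst (0ℚ <_) (expand (ε k * p) r) sum-positive))

-- The expansion of the eigenmatrix

shift : ℕ → (ℕ → ℚ) → ℕ → ℚ
shift zero    f j       = f j
shift (suc n) f zero    = 0ℚ
shift (suc n) f (suc j) = shift n f j

shift-+ : ∀ n f k → shift n f (n ℕ.+ k) ≡ f k
shift-+ zero    f k = refl
shift-+ (suc n) f k = shift-+ n f k

shift-< : ∀ {n j} f → j ℕ.< n → shift n f j ≡ 0ℚ
shift-< {suc n} {zero}  f _         = refl
shift-< {suc n} {suc j} f (s≤s j<n) = shift-< f j<n

-- Dictionary, with j = n + k, d = j + r and [m] the q-integer: x, w, u stand for [n], [k], [r]; y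
-- and v for q^n and q^k; z and s for [j] and [j + 1]; N and N′ for [k + r] and [k + r + 1]; D for
-- [d]. Everything is a polynomial in q, x, w, u, so the recurrence becomes a plain ring identity.
module _ (q x w u : ℚ) {y v z s N N′ D : ℚ} where

  -- G-recurrence times q, with x (n ∸ 1) eliminated by q * x (n ∸ 1) = x n - 1: for c this
  -- also holds at n = 0, where x 0 = 0 is a factor.
  scaled-recurrence : ∀ α β →
    y ≡ 1ℚ + (q - 1ℚ) * x → v ≡ 1ℚ + (q - 1ℚ) * w →
    z ≡ x + y * w → s ≡ z + y * v → N ≡ w + v * u → N′ ≡ 1ℚ + q * N → D ≡ z + y * v * u →
      q * s * (1ℚ + α * z) * (- (v * u))
    ≡ x * (q + α * (x - 1ℚ)) * (- (v * N′))
    + (w + v) * (q * (x * (β - α * N) - N)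
              - (q * (D * β) - q * ((D - z) * (β - α * z)) - z * (q + α * (z - 1ℚ)))
              + y * (q * (w * β) - α * (w * (z - 1ℚ))))
  scaled-recurrence α β refl refl refl refl refl refl refl = identity q x w u α β
    where
    identity : ∀ b x w u α β →
      let y = 1ℚ + (b - 1ℚ) * x
          v = 1ℚ + (b - 1ℚ) * w
          z = x + y * w
          N = w + v * u
          D = z + y * v * u
      in  b * (z + y * v) * (1ℚ + α * z) * (- (v * u))
        ≡ x * (b + α * (x - 1ℚ)) * (- (v * (1ℚ + b * N)))
        + (w + v) * (b * (x * (β - α * N) - N)
                  - (b * (D * β) - b * ((D - z) * (β - α * z)) - z * (b + α * (z - 1ℚ)))
                  + y * (b * (w * β) - α * (w * (z - 1ℚ))))
    identity = solve-∀ ℚ-ring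

-- Only the initial value and the recursion of the q-integers are assumed, which covers q = 1 (where
-- x k = k) together with q ≠ 1.
module QIntegers (q : ℚ) (0<q : 0ℚ < q) (x : ℕ → ℚ)
                 (x-zero : x 0 ≡ 0ℚ) (x-suc : ∀ k → x (suc k) ≡ 1ℚ + q * x k) where

  -- q ^ k, written in terms of the q-integer x k.
  pow : ℕ → ℚ
  pow k = 1ℚ + (q - 1ℚ) * x k

  pow-suc : ∀ k → pow (suc k) ≡ q * pow k
  pow-suc k = trans (cong (λ t → 1ℚ + (q - 1ℚ) * t) (x-suc k)) (expand q (x k))
    where
    expand : ∀ q t → 1ℚ + (q - 1ℚ) * (1ℚ + q * t) ≡ q * (1ℚ + (q - 1ℚ) * t)
    expand = solve-∀ ℚ-ring

  pow-zero : pow 0 ≡ 1ℚ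
  pow-zero = trans (cong (λ t → 1ℚ + (q - 1ℚ) * t) x-zero) (expand q)
    where
    expand : ∀ q → 1ℚ + (q - 1ℚ) * 0ℚ ≡ 1ℚ
    expand = solve-∀ ℚ-ring

  pow-positive : ∀ k → 0ℚ < pow k
  pow-positive zero    = subst (0ℚ <_) (sym pow-zero) (positive⁻¹ 1ℚ)
  pow-positive (suc k) = subst (0ℚ <_) (sym (pow-suc k)) (*-pos 0<q (pow-positive k))

  x-one : x 1 ≡ 1ℚ
  x-one = trans (x-suc 0) (trans (cong (λ t → 1ℚ + q * t) x-zero) (expand q))
    where
    expand : ∀ q → 1ℚ + q * 0ℚ ≡ 1ℚ
    expand = solve-∀ ℚ-ring

  x-+ : ∀ m n → x (m ℕ.+ n) ≡ x m + pow m * x n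
  x-+ zero    n = sym (trans (cong₂ (λ s t → s + t * x n) x-zero pow-zero) (expand (x n)))
    where
    expand : ∀ t → 0ℚ + 1ℚ * t ≡ t
    expand = solve-∀ ℚ-ring
  x-+ (suc m) n = begin
    x (suc (m ℕ.+ n))                        ≡⟨ x-suc (m ℕ.+ n) ⟩
    1ℚ + q * x (m ℕ.+ n)                     ≡⟨ cong (λ t → 1ℚ + q * t) (x-+ m n) ⟩
    1ℚ + q * (x m + pow m * x n)             ≡⟨ expand q (x m) (pow m) (x n) ⟩
    (1ℚ + q * x m) + q * pow m * x n
      ≡⟨ cong₂ (λ s t → s + t * x n) (x-suc m) (pow-suc m) ⟨
    x (suc m) + pow (suc m) * x n            ∎
    where
    open ≡-Reasoning
    expand : ∀ q s p t → 1ℚ + q * (s + p * t) ≡ (1ℚ + q * s) + q * p * t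
    expand = solve-∀ ℚ-ring

  pow-+ : ∀ m n → pow (m ℕ.+ n) ≡ pow m * pow n
  pow-+ m n = trans (cong (λ t → 1ℚ + (q - 1ℚ) * t) (x-+ m n)) (expand q (x m) (x n))
    where
    expand : ∀ q s t → 1ℚ + (q - 1ℚ) * (s + (1ℚ + (q - 1ℚ) * s) * t)
                     ≡ (1ℚ + (q - 1ℚ) * s) * (1ℚ + (q - 1ℚ) * t)
    expand = solve-∀ ℚ-ring

  x-suc′ : ∀ k → x (suc k) ≡ x k + pow k
  x-suc′ k = trans (x-suc k) (expand q (x k))
    where
    expand : ∀ q t → 1ℚ + q * t ≡ t + (1ℚ + (q - 1ℚ) * t)
    expand = solve-∀ ℚ-ring

  x-mono-< : ∀ {m n} → m ℕ.< n → x m < x n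
  x-mono-< {m} {suc n} (s≤s m≤n) = <-≤-trans (step m) (mono (ℕ.≤⇒≤′ (s≤s m≤n)))
    where
    step : ∀ k → x k < x (suc k)
    step k = subst₂ _<_ (+-identityʳ (x k)) (sym (x-suc′ k)) (+-monoʳ-< (x k) (pow-positive k))
    mono : ∀ {k l} → k ℕ.≤′ l → x k ≤ x l
    mono ℕ.≤′-refl       = ≤-refl
    mono (ℕ.≤′-step k≤l) = ≤-trans (mono k≤l) (<⇒≤ (step _))

  x-positive : ∀ k → 0ℚ < x (suc k)
  x-positive k = subst (_< x (suc k)) x-zero (x-mono-< (s≤s z≤n))

  1/x : ℕ → ℚ
  1/x k = 1ℚ ÷₀ x (suc k)

  x-inverse : ∀ k → x (suc k) * 1/x k ≡ 1ℚ
  x-inverse k = ÷₀-inverse (pos⇒≢0 (x-positive k))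

  -- The coefficient of t ^ k in ∏_{h < N} (1 - q ^ h t).
  G : ℕ → ℕ → ℚ
  G N zero    = 1ℚ
  G N (suc k) = - (pow k * x (N ∸ k) * 1/x k) * G N k

  -- The absorption identity [k+1] [N+1, k+1] = [N+1] [N, k] for Gaussian binomials. The definition
  -- of `G` keeps N fixed; this form changes N, as needed to compare neighbouring Newton
  -- coefficients.
  G-suc-suc : ∀ N k → G (suc N) (suc k) ≡ - (pow k * x (suc N) * 1/x k) * G N k
  G-suc-suc N zero    = refl
  G-suc-suc N (suc k) = trans (cong (- (pow (suc k) * x (N ∸ k) * 1/x (suc k)) *_) (G-suc-suc N k))
    (swap (pow k) (pow (suc k)) (1/x k) (1/x (suc k)) (x (suc N)) (x (N ∸ k)) (G N k))
    where
    swap : ∀ p p′ r r′ s t g → - (p′ * t * r′) * (- (p * s * r) * g) ≡ - (p′ * s * r′) * (- (p * t * r) * g)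
    swap = solve-∀ ℚ-ring

  G-alternating : ∀ {N k} → k ℕ.≤ N → 0ℚ < ε k * G N k
  G-alternating {N} {zero}  _   = positive⁻¹ 1ℚ
  G-alternating {N} {suc k} k<N = subst (0ℚ <_) (expand (pow k) (x (N ∸ k)) (1/x k) (ε k) (G N k))
    (*-pos (*-pos (*-pos (pow-positive k) x[N∸k]-positive) (÷₀-positive (x-positive k)))
      (G-alternating (ℕ.<⇒≤ k<N)))
    where
    x[N∸k]-positive : 0ℚ < x (N ∸ k)
    x[N∸k]-positive = subst (_< x (N ∸ k)) x-zero (x-mono-< (ℕ.m<n⇒0<n∸m k<N))
    expand : ∀ p s r e g → p * s * r * (e * g) ≡ - e * (- (p * s * r) * g)
    expand = solve-∀ ℚ-ring

  -- The formulas of `Classical` over the abstract sequence `x`, with β as an argument because it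
  -- will vary. For x k = `gauss b k 1ℤ` they agree with `Classical` by definition.
  module Expansion (d : ℕ) (α : ℚ) where

    c : ℕ → ℚ
    c i = x i * (1ℚ + α * x (i ∸ 1))

    bᵢ : ℚ → ℕ → ℚ
    bᵢ β i = (x d - x i) * (β - α * x i)

    a : ℚ → ℕ → ℚ
    a β i = bᵢ β 0 - bᵢ β i - c i

    θ : ℚ → ℕ → ℚ
    θ β i = x (d ∸ i) * (β - α * x i) - x i

    c-one : c 1 ≡ 1ℚ
    c-one = trans (cong₂ (λ s t → s * (1ℚ + α * t)) x-one x-zero) (expand α)
      where
      expand : ∀ α → 1ℚ * (1ℚ + α * 0ℚ) ≡ 1ℚ
      expand = solve-∀ ℚ-ring

    bᵢ-zero : ∀ β → bᵢ β 0 ≡ x d * β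
    bᵢ-zero β = trans (cong (λ t → (x d - t) * (β - α * t)) x-zero) (expand (x d) α β)
      where
      expand : ∀ s α β → (s - 0ℚ) * (β - α * 0ℚ) ≡ s * β
      expand = solve-∀ ℚ-ring

    a-zero : ∀ β → a β 0 ≡ 0ℚ
    a-zero β = trans (cong (λ t → bᵢ β 0 - bᵢ β 0 - t * (1ℚ + α * t)) x-zero) (expand (bᵢ β 0) α)
      where
      expand : ∀ s α → s - s - 0ℚ * (1ℚ + α * 0ℚ) ≡ 0ℚ
      expand = solve-∀ ℚ-ring

    q*c : ∀ n → q * c n ≡ x n * (q + α * (x n - 1ℚ))
    q*c zero = trans (cong (λ t → q * (t * (1ℚ + α * t))) x-zero)
      (trans (expand q α) (cong (λ t → t * (q + α * (t - 1ℚ))) (sym x-zero)))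
      where
      expand : ∀ q α → q * (0ℚ * (1ℚ + α * 0ℚ)) ≡ 0ℚ * (q + α * (0ℚ - 1ℚ))
      expand = solve-∀ ℚ-ring
    q*c (suc n) = trans (cong (λ t → q * (t * (1ℚ + α * x n))) (x-suc n))
      (trans (expand q α (x n)) (cong (λ t → t * (q + α * (t - 1ℚ))) (sym (x-suc n))))
      where
      expand : ∀ q α t → q * ((1ℚ + q * t) * (1ℚ + α * t))
                       ≡ (1ℚ + q * t) * (q + α * (1ℚ + q * t - 1ℚ))
      expand = solve-∀ ℚ-ring

    -- The relation q [m - 1] = [m] - 1 fails for truncated subtraction at m = 0; the factor x k
    -- vanishes when n + k = 0.
    x*q*x-pred : ∀ n k → x k * (q * x (n ℕ.+ k ∸ 1)) ≡ x k * (x (n ℕ.+ k) - 1ℚ)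
    x*q*x-pred n zero = trans (cong (_* (q * x (n ℕ.+ 0 ∸ 1))) x-zero)
      (trans (vanish (q * x (n ℕ.+ 0 ∸ 1)) (x (n ℕ.+ 0) - 1ℚ)) (cong (_* (x (n ℕ.+ 0) - 1ℚ)) (sym x-zero)))
      where
      vanish : ∀ s t → 0ℚ * s ≡ 0ℚ * t
      vanish = solve-∀ ℚ-ring
    x*q*x-pred n (suc k) rewrite ℕ.+-suc n k = cong (x (suc k) *_)
      (sym (trans (cong (_- 1ℚ) (x-suc (n ℕ.+ k))) (expand (q * x (n ℕ.+ k)))))
      where
      expand : ∀ t → 1ℚ + t - 1ℚ ≡ t
      expand = solve-∀ ℚ-ring

    -- Both values at `suc k` are explicit multiples of `G (k + r) k`, one by definition and the
    -- other by `G-suc-suc`. With this factor and `1/x k` split off, `unscaled` remains, an identity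
    -- between q-integers proved after multiplication by q. The last summand is - b_{j-1} G (k + r)
    -- (k - 1) for j = n + k, rewritten so that k - 1 does not occur.
    G-recurrence : ∀ β n k r → d ≡ n ℕ.+ k ℕ.+ r →
      c (suc (n ℕ.+ k)) * G (k ℕ.+ r) (suc k)
        ≡ c n * G (suc (k ℕ.+ r)) (suc k)
        + (x n * (β - α * x (k ℕ.+ r)) - x (k ℕ.+ r) - a β (n ℕ.+ k)) * G (k ℕ.+ r) k
        + pow n * x k * (β - α * x (n ℕ.+ k ∸ 1)) * G (k ℕ.+ r) k
    G-recurrence β n k r d≡ = begin
      c (suc j) * (- (v * x (N ∸ k) * ρ) * g)
        ≡⟨ cong (λ m → c (suc j) * (- (v * x m * ρ) * g)) (ℕ.m+n∸m≡n k r) ⟩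
      c (suc j) * (- (v * u * ρ) * g)
        ≡⟨ factor (c (suc j)) v u ρ g ⟩
      c (suc j) * (- (v * u)) * (ρ * g)
        ≡⟨ cong (_* (ρ * g)) unscaled ⟩
      (c n * (- (v * x (suc N))) + (x k + v) * K) * (ρ * g)
        ≡⟨ unfactor (c n) v (x (suc N)) (x k + v) K ρ g ⟩
      c n * (- (v * x (suc N) * ρ) * g) + (x k + v) * ρ * (K * g)
        ≡⟨ cong₂ (λ s t → c n * s + t * (K * g)) (sym (G-suc-suc N k))
             (trans (cong (_* ρ) (sym (x-suc′ k))) (x-inverse k)) ⟩
      c n * G (suc N) (suc k) + 1ℚ * (K * g)
        ≡⟨ split (c n * G (suc N) (suc k)) (θ′ - a β j) (y * x k * (β - α * e)) g ⟩
      c n * G (suc N) (suc k) + (θ′ - a β j) * g + y * x k * (β - α * e) * g ∎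
      where
      open ≡-Reasoning
      j = n ℕ.+ k
      N = k ℕ.+ r
      y = pow n
      v = pow k
      u = x r
      ρ = 1/x k
      g = G N k
      e = x (j ∸ 1)
      θ′ = x n * (β - α * x N) - x N
      K = θ′ - a β j + y * x k * (β - α * e)
      D≡ : x d ≡ x j + y * v * u
      D≡ = trans (cong x d≡) (trans (x-+ j r) (cong (λ t → x j + t * u) (pow-+ n k)))
      s≡ : x (suc j) ≡ x j + y * v
      s≡ = trans (x-suc′ j) (cong (x j +_) (pow-+ n k))
      factor : ∀ c v u ρ g → c * (- (v * u * ρ) * g) ≡ c * (- (v * u)) * (ρ * g)
      factor = solve-∀ ℚ-ring
      unfactor : ∀ c v N s K ρ g → (c * (- (v * N)) + s * K) * (ρ * g)
                                 ≡ c * (- (v * N * ρ) * g) + s * ρ * (K * g)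
      unfactor = solve-∀ ℚ-ring
      split : ∀ m s t g → m + 1ℚ * ((s + t) * g) ≡ m + s * g + t * g
      split = solve-∀ ℚ-ring
      distribute : ∀ q cn vN s θ D B cj y w β α e →
        q * (cn * vN + s * (θ - (D - B - cj) + y * w * (β - α * e)))
        ≡ q * cn * vN + s * (q * θ - (q * D - q * B - q * cj)
            + y * (q * (w * β) - α * (w * (q * e))))
      distribute = solve-∀ ℚ-ring
      regroup : ∀ q s t m → q * (s * t * m) ≡ q * s * t * m
      regroup = solve-∀ ℚ-ring
      unscaled : c (suc j) * (- (v * u)) ≡ c n * (- (v * x (suc N))) + (x k + v) * K
      unscaled = *-cancelˡ (pos⇒≢0 0<q) (begin
        q * (c (suc j) * (- (v * u)))
          ≡⟨ regroup q (x (suc j)) (1ℚ + α * x j) (- (v * u)) ⟩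
        q * x (suc j) * (1ℚ + α * x j) * (- (v * u))
          ≡⟨ scaled-recurrence q (x n) (x k) u α β refl refl (x-+ n k) s≡ (x-+ k r) (x-suc N) D≡ ⟩
        _ ≡⟨ cong₂ (λ s t → s * (- (v * x (suc N))) + (x k + v) * t)
               (q*c n)
               (cong₂ _+_
                 (cong₂ (λ s t → q * θ′ - (q * s - q * bᵢ β j - t)) (bᵢ-zero β) (q*c j))
                 (cong (λ t → y * (q * (x k * β) - α * t)) (x*q*x-pred n k))) ⟨
        q * c n * (- (v * x (suc N))) + (x k + v) *
          (q * θ′ - (q * bᵢ β 0 - q * bᵢ β j - q * c j)
            + y * (q * (x k * β) - α * (x k * (q * e))))
          ≡⟨ distribute q (c n) (- (v * x (suc N))) (x k + v) θ′ (bᵢ β 0) (bᵢ β j) (c j) y (x k) β α e ⟨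
        q * (c n * (- (v * x (suc N))) + (x k + v) * K) ∎)

    -- The coefficients of t^n ∏_{h < d-n} (1 - q^h t). The expansion thus says that Σ_j P i j t^j
    -- is the sum of these polynomials weighted by τ_n, over n ≤ d.
    coef : ℕ → ℕ → ℚ
    coef n = shift n (G (d ∸ n))

    -- The contribution to τ_n that comes from θ_i τ_{n-1} = θ_{d-n+1} τ_{n-1} + c_n τ_n.
    pred-term : ℕ → ℕ → ℚ
    pred-term zero    j = 0ℚ
    pred-term (suc n) j = c (suc n) * coef n j

    prev : ℚ → (ℕ → ℚ) → ℕ → ℚ
    prev β f zero    = 0ℚ
    prev β f (suc j) = bᵢ β j * f j

    coef-recurrence-≤ : ∀ β n k r → n ℕ.+ k ℕ.+ r ≡ d →
      c (suc (n ℕ.+ k)) * coef n (suc (n ℕ.+ k)) ≡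
      pred-term n (n ℕ.+ k) + (θ β (d ∸ n) - a β (n ℕ.+ k)) * coef n (n ℕ.+ k) - prev β (coef n) (n ℕ.+ k)
    coef-recurrence-≤ β n k r eq = begin
      c (suc j) * coef n (suc j)
        ≡⟨ cong (c (suc j) *_) (trans (cong (coef n) (sym (ℕ.+-suc n k))) (coef≡G (suc k))) ⟩
      c (suc j) * G (k ℕ.+ r) (suc k)
        ≡⟨ G-recurrence β n k r (sym eq) ⟩
      c n * G (suc (k ℕ.+ r)) (suc k)
        + (x n * (β - α * x (k ℕ.+ r)) - x (k ℕ.+ r) - a β j) * G (k ℕ.+ r) k
        + pow n * x k * (β - α * x (j ∸ 1)) * G (k ℕ.+ r) k
        ≡⟨ cong₂ _+_
             (cong₂ _+_ (pred-term≡ n eq)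
               (cong₂ (λ t g → (t - a β j) * g) θ≡ (coef≡G k)))
             (prev≡ n k eq) ⟨
      pred-term n j + (θ β (d ∸ n) - a β j) * coef n j - prev β (coef n) j ∎
      where
      open ≡-Reasoning
      j = n ℕ.+ k
      n≤d : n ℕ.≤ d
      n≤d = subst (n ℕ.≤_) eq (ℕ.≤-trans (ℕ.m≤m+n n k) (ℕ.m≤m+n j r))
      d∸n : ∀ n k → n ℕ.+ k ℕ.+ r ≡ d → d ∸ n ≡ k ℕ.+ r
      d∸n n k eq = trans (cong (_∸ n) (trans (sym eq) (ℕ.+-assoc n k r))) (ℕ.m+n∸m≡n n (k ℕ.+ r))
      coef≡G : ∀ l → coef n (n ℕ.+ l) ≡ G (k ℕ.+ r) l
      coef≡G l = trans (shift-+ n (G (d ∸ n)) l) (cong (λ N → G N l) (d∸n n k eq))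
      θ≡ : θ β (d ∸ n) ≡ x n * (β - α * x (k ℕ.+ r)) - x (k ℕ.+ r)
      θ≡ = cong₂ (λ s t → x s * (β - α * x t) - x t) (ℕ.m∸[m∸n]≡n n≤d) (d∸n n k eq)
      pred-term≡ : ∀ n → n ℕ.+ k ℕ.+ r ≡ d → pred-term n (n ℕ.+ k) ≡ c n * G (suc (k ℕ.+ r)) (suc k)
      pred-term≡ zero _ = sym (trans (cong (λ t → t * (1ℚ + α * t) * g) x-zero) (expand α g))
        where
        g = G (suc (k ℕ.+ r)) (suc k)
        expand : ∀ α t → 0ℚ * (1ℚ + α * 0ℚ) * t ≡ 0ℚ
        expand = solve-∀ ℚ-ring
      pred-term≡ (suc m) eq = cong (c (suc m) *_) (trans (cong (coef m) (sym (ℕ.+-suc m k)))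
        (trans (shift-+ m (G (d ∸ m)) (suc k)) (cong (λ N → G N (suc k))
          (d∸n m (suc k) (trans (cong (ℕ._+ r) (ℕ.+-suc m k)) eq)))))
      prev≡ : ∀ n k → n ℕ.+ k ℕ.+ r ≡ d →
        - prev β (coef n) (n ℕ.+ k) ≡ pow n * x k * (β - α * x (n ℕ.+ k ∸ 1)) * G (k ℕ.+ r) k
      prev≡ zero zero _ = sym (trans (cong (λ t → pow 0 * t * (β - α * t) * 1ℚ) x-zero) (expand (pow 0) α β))
        where
        expand : ∀ p α β → p * 0ℚ * (β - α * 0ℚ) * 1ℚ ≡ 0ℚ
        expand = solve-∀ ℚ-ring
      prev≡ (suc m) zero _ = begin
        - (bᵢ β (m ℕ.+ 0) * coef (suc m) (m ℕ.+ 0))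
          ≡⟨ cong (λ t → - (bᵢ β (m ℕ.+ 0) * t)) (shift-< _ (s≤s (ℕ.≤-reflexive (ℕ.+-identityʳ m)))) ⟩
        - (bᵢ β (m ℕ.+ 0) * 0ℚ)
          ≡⟨ vanish (bᵢ β (m ℕ.+ 0)) (pow (suc m)) (β - α * x (m ℕ.+ 0)) ⟩
        pow (suc m) * 0ℚ * (β - α * x (m ℕ.+ 0)) * 1ℚ
          ≡⟨ cong (λ t → pow (suc m) * t * (β - α * x (m ℕ.+ 0)) * 1ℚ) x-zero ⟨
        pow (suc m) * x 0 * (β - α * x (m ℕ.+ 0)) * 1ℚ ∎
        where
        vanish : ∀ s p t → - (s * 0ℚ) ≡ p * 0ℚ * t * 1ℚ
        vanish = solve-∀ ℚ-ring
      -- Here [d] - [n + k] = q^(n+k) [r + 1], and [r + 1] is exactly the factor by which `G` passes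
      -- from k to `suc k`. The 1 that is inserted becomes x (suc k) * 1/x k and completes that
      -- factor.
      prev≡ n (suc k) eq rewrite ℕ.+-suc n k = begin
        - ((x d - x (n ℕ.+ k)) * B * coef n (n ℕ.+ k))
          ≡⟨ cong₂ (λ s t → - ((s - x (n ℕ.+ k)) * B * t)) xd≡ coef≡ ⟩
        - ((x (n ℕ.+ k) + pow n * pow k * x (suc r) - x (n ℕ.+ k)) * B * g)
          ≡⟨ expand (x (n ℕ.+ k)) (pow n) (pow k) (x (suc r)) B g ⟩
        pow n * 1ℚ * B * (- (pow k * x (suc r)) * g)
          ≡⟨ cong (λ t → pow n * t * B * (- (pow k * x (suc r)) * g)) (x-inverse k) ⟨
        pow n * (x (suc k) * 1/x k) * B * (- (pow k * x (suc r)) * g)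
          ≡⟨ regroup (pow n) (x (suc k)) (1/x k) B (pow k) (x (suc r)) g ⟩
        pow n * x (suc k) * B * (- (pow k * x (suc r) * 1/x k) * g)
          ≡⟨ cong (λ m → pow n * x (suc k) * B * (- (pow k * x m * 1/x k) * g)) r≡ ⟨
        pow n * x (suc k) * B * (- (pow k * x (suc (k ℕ.+ r) ∸ k) * 1/x k) * g) ∎
        where
        B = β - α * x (n ℕ.+ k)
        g = G (suc (k ℕ.+ r)) k
        r≡ : suc (k ℕ.+ r) ∸ k ≡ suc r
        r≡ = trans (cong (_∸ k) (sym (ℕ.+-suc k r))) (ℕ.m+n∸m≡n k (suc r))
        eq′ : n ℕ.+ k ℕ.+ suc r ≡ d
        eq′ = trans (ℕ.+-suc (n ℕ.+ k) r) eq
        xd≡ : x d ≡ x (n ℕ.+ k) + pow n * pow k * x (suc r)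
        xd≡ = trans (cong x (sym eq′)) (trans (x-+ (n ℕ.+ k) (suc r))
          (cong (λ t → x (n ℕ.+ k) + t * x (suc r)) (pow-+ n k)))
        coef≡ : coef n (n ℕ.+ k) ≡ g
        coef≡ = trans (shift-+ n (G (d ∸ n)) k) (cong (λ N → G N k)
          (trans (cong (_∸ n) (trans (sym eq′) (trans (ℕ.+-assoc n k (suc r)) (cong (n ℕ.+_) (ℕ.+-suc k r)))))
            (ℕ.m+n∸m≡n n (suc (k ℕ.+ r)))))
        expand : ∀ z p v u B g → - ((z + p * v * u - z) * B * g) ≡ p * 1ℚ * B * (- (v * u) * g)
        expand = solve-∀ ℚ-ring
        regroup : ∀ p s ρ B v u g → p * (s * ρ) * B * (- (v * u) * g) ≡ p * s * B * (- (v * u * ρ) * g)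
        regroup = solve-∀ ℚ-ring

    coef-recurrence : ∀ β n j → j ℕ.< d →
      c (suc j) * coef n (suc j) ≡
      pred-term n j + (θ β (d ∸ n) - a β j) * coef n j - prev β (coef n) j
    coef-recurrence β n j j<d with n ℕ.≤? j
    ... | yes n≤j with k , refl ← ℕ.m≤n⇒∃[o]m+o≡n n≤j with r , eq ← ℕ.m≤n⇒∃[o]m+o≡n (ℕ.<⇒≤ j<d) =
      coef-recurrence-≤ β n k r eq
    ... | no n≰j = begin
      c (suc j) * coef n (suc j)          ≡⟨ top n n≰j ⟩
      pred-term n j                       ≡⟨ expand (pred-term n j) (θ β (d ∸ n) - a β j) ⟩
      pred-term n j + (θ β (d ∸ n) - a β j) * 0ℚ - 0ℚ
        ≡⟨ cong₂ (λ s t → pred-term n j + (θ β (d ∸ n) - a β j) * s - t)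
             (shift-< {n} _ (ℕ.≰⇒> n≰j)) (prev≡ j (ℕ.≰⇒> n≰j)) ⟨
      pred-term n j + (θ β (d ∸ n) - a β j) * coef n j - prev β (coef n) j ∎
      where
      open ≡-Reasoning
      expand : ∀ s t → s ≡ s + t * 0ℚ - 0ℚ
      expand = solve-∀ ℚ-ring
      prev≡ : ∀ j → j ℕ.< n → prev β (coef n) j ≡ 0ℚ
      prev≡ zero    _   = refl
      prev≡ (suc j) j<n = trans
        (cong (bᵢ β j *_) (shift-< {n} _ (ℕ.<-trans (ℕ.n<1+n j) j<n)))
        (*-zeroʳ (bᵢ β j))
      -- Above the diagonal everything vanishes except at n = j + 1, where both coefficients are
      -- diagonal entries, equal to 1.
      top : ∀ n → ¬ n ℕ.≤ j → c (suc j) * coef n (suc j) ≡ pred-term n j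
      top zero    0≰j = contradiction z≤n 0≰j
      top (suc m) m≮j with ℕ.m≤n⇒m<n∨m≡n (ℕ.s≤s⁻¹ (ℕ.≰⇒> m≮j))
      ... | inj₂ refl = cong (c (suc j) *_)
        (trans (diagonal m (G (d ∸ suc m))) (sym (diagonal m (G (d ∸ m)))))
        where
        diagonal : ∀ n f → shift n f n ≡ f 0
        diagonal n f = trans (cong (shift n f) (sym (ℕ.+-identityʳ n))) (shift-+ n f 0)
      ... | inj₁ j<m = trans
        (trans (cong (c (suc j) *_) (shift-< {m} _ j<m)) (*-zeroʳ (c (suc j))))
        (sym (trans (cong (c (suc m) *_) (shift-< {m} _ j<m)) (*-zeroʳ (c (suc m)))))

    coef-alternating : ∀ m k → m ℕ.+ k ℕ.≤ d → 0ℚ < ε k * coef m (m ℕ.+ k)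
    coef-alternating m k m+k≤d = subst (λ t → 0ℚ < ε k * t) (sym (shift-+ m (G (d ∸ m)) k))
      (G-alternating (subst (ℕ._≤ d ∸ m) (ℕ.m+n∸m≡n m k) (ℕ.∸-monoˡ-≤ m m+k≤d)))

    coef-diagonal-positive : ∀ {j} → j ℕ.≤ d → 0ℚ < coef j j
    coef-diagonal-positive {j} j≤d = subst (0ℚ <_)
      (trans (*-identityˡ (coef j (j ℕ.+ 0))) (cong (coef j) (ℕ.+-identityʳ j)))
      (coef-alternating j 0 (subst (ℕ._≤ d) (sym (ℕ.+-identityʳ j)) j≤d))

    -- The Newton sum: its recurrence and its growth in β

    module Positive (c-positive : ∀ {n} → n ℕ.< d → 0ℚ < c (suc n)) where

      1/c : ℕ → ℚ
      1/c n = 1ℚ ÷₀ c (suc n)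

      τ : ℚ → ℕ → ℕ → ℚ
      τ β i zero    = 1ℚ
      τ β i (suc n) = (θ β i - θ β (d ∸ n)) * 1/c n * τ β i n

      S : ℚ → ℕ → ℕ → ℕ → ℚ
      S β i zero    j = coef zero j * τ β i zero
      S β i (suc n) j = S β i n j + coef (suc n) j * τ β i (suc n)

      -- The last term is the part of θ_i τ_n that a partial sum cannot absorb: it equals c_{n+1}
      -- τ_{n+1} times `coef n j`. It cancels against `pred-term` when the summand n + 1 is added,
      -- and a new remainder of the same shape appears.
      S-recurrence-≤ : ∀ β i j n → j ℕ.< d → n ℕ.≤ d →
        c (suc j) * S β i n (suc j) ≡
        (θ β i - a β j) * S β i n j - prev β (S β i n) j - (θ β i - θ β (d ∸ n)) * coef n j * τ β i n
      S-recurrence-≤ β i j zero j<d _ = begin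
        c (suc j) * (coef 0 (suc j) * 1ℚ)
          ≡⟨ assoc (c (suc j)) (coef 0 (suc j)) ⟩
        c (suc j) * coef 0 (suc j)
          ≡⟨ coef-recurrence β 0 j j<d ⟩
        0ℚ + (θ β d - a β j) * coef 0 j - prev β (coef 0) j
          ≡⟨ cong (λ t → 0ℚ + (θ β d - a β j) * coef 0 j - t) (prev≡ j) ⟩
        0ℚ + (θ β d - a β j) * coef 0 j - prev β (S β i 0) j
          ≡⟨ expand (θ β i) (θ β d) (a β j) (coef 0 j) (prev β (S β i 0) j) ⟩
        (θ β i - a β j) * (coef 0 j * 1ℚ) - prev β (S β i 0) j - (θ β i - θ β d) * coef 0 j * 1ℚ ∎
        where
        open ≡-Reasoning
        assoc : ∀ s t → s * (t * 1ℚ) ≡ s * t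
        assoc = solve-∀ ℚ-ring
        prev≡ : ∀ j → prev β (coef 0) j ≡ prev β (S β i 0) j
        prev≡ zero    = refl
        prev≡ (suc j) = cong (bᵢ β j *_) (sym (*-identityʳ (coef 0 j)))
        expand : ∀ s t a g p → 0ℚ + (t - a) * g - p ≡ (s - a) * (g * 1ℚ) - p - (s - t) * g * 1ℚ
        expand = solve-∀ ℚ-ring
      S-recurrence-≤ β i j (suc n) j<d n<d = begin
        c (suc j) * (S β i n (suc j) + coef (suc n) (suc j) * t′)
          ≡⟨ distribute (c (suc j)) (S β i n (suc j)) (coef (suc n) (suc j)) t′ ⟩
        c (suc j) * S β i n (suc j) + c (suc j) * coef (suc n) (suc j) * t′
          ≡⟨ cong₂ (λ s r → s + r * t′) (S-recurrence-≤ β i j n j<d (ℕ.<⇒≤ n<d))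
               (coef-recurrence β (suc n) j j<d) ⟩
        (θi - a β j) * S β i n j - prev β (S β i n) j - (θi - θn) * coef n j * t
          + (c (suc n) * coef n j + (θn′ - a β j) * coef (suc n) j - prev β (coef (suc n)) j) * t′
          ≡⟨ regroup (θi - a β j) (S β i n j) (prev β (S β i n) j) (θi - θn) (coef n j) t
               (c (suc n)) (θn′ - a β j) (coef (suc n) j) (prev β (coef (suc n)) j) t′ ⟩
        (θi - a β j) * S β i n j - (prev β (S β i n) j + prev β (coef (suc n)) j * t′)
          + (c (suc n) * t′ - (θi - θn) * t) * coef n j + (θn′ - a β j) * coef (suc n) j * t′
          ≡⟨ cong₂ (λ s r → (θi - a β j) * S β i n j - s
                 + (r - (θi - θn) * t) * coef n j + (θn′ - a β j) * coef (suc n) j * t′)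
               (prev-+ j) c*τ ⟩
        (θi - a β j) * S β i n j - prev β (S β i (suc n)) j
          + ((θi - θn) * t - (θi - θn) * t) * coef n j + (θn′ - a β j) * coef (suc n) j * t′
          ≡⟨ collect θi θn θn′ (a β j) (S β i n j) (prev β (S β i (suc n)) j) t (coef n j) (coef (suc n) j) t′ ⟩
        (θi - a β j) * (S β i n j + coef (suc n) j * t′) - prev β (S β i (suc n)) j
          - (θi - θn′) * coef (suc n) j * t′ ∎
        where
        open ≡-Reasoning
        t t′ θi θn θn′ : ℚ
        t = τ β i n
        t′ = τ β i (suc n)
        θi = θ β i
        θn = θ β (d ∸ n)
        θn′ = θ β (d ∸ suc n)
        distribute : ∀ c s g t → c * (s + g * t) ≡ c * s + c * g * t
        distribute = solve-∀ ℚ-ring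
        regroup : ∀ e s p h g t c e′ g′ p′ t′ →
          e * s - p - h * g * t + (c * g + e′ * g′ - p′) * t′
          ≡ e * s - (p + p′ * t′) + (c * t′ - h * t) * g + e′ * g′ * t′
        regroup = solve-∀ ℚ-ring
        collect : ∀ θi θn θn′ a s p t g g′ t′ →
          (θi - a) * s - p + ((θi - θn) * t - (θi - θn) * t) * g + (θn′ - a) * g′ * t′
          ≡ (θi - a) * (s + g′ * t′) - p - (θi - θn′) * g′ * t′
        collect = solve-∀ ℚ-ring
        prev-+ : ∀ j → prev β (S β i n) j + prev β (coef (suc n)) j * t′ ≡ prev β (S β i (suc n)) j
        prev-+ zero    = *-zeroˡ′ t′
          where
          *-zeroˡ′ : ∀ t → 0ℚ + 0ℚ * t ≡ 0ℚ
          *-zeroˡ′ = solve-∀ ℚ-ring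
        prev-+ (suc j) = sym (distribute (bᵢ β j) (S β i n j) (coef (suc n) j) t′)
        c*τ : c (suc n) * t′ ≡ (θi - θn) * t
        c*τ = trans (swap (c (suc n)) (θi - θn) (1/c n) t)
          (trans (cong (_* ((θi - θn) * t)) (÷₀-inverse (pos⇒≢0 (c-positive n<d)))) (*-identityˡ _))
          where
          swap : ∀ c h r t → c * (h * r * t) ≡ c * r * (h * t)
          swap = solve-∀ ℚ-ring

      -- At n = d the remainder carries the factor `coef d j`, which is zero for j < d.
      S-recurrence : ∀ β i j → j ℕ.< d →
        c (suc j) * S β i d (suc j) ≡ (θ β i - a β j) * S β i d j - prev β (S β i d) j
      S-recurrence β i j j<d = trans (S-recurrence-≤ β i j d j<d ℕ.≤-refl)
        (trans (cong (λ t → s - p - h * t * τ β i d) (shift-< {d} _ j<d))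
          (expand s p h (τ β i d)))
        where
        s = (θ β i - a β j) * S β i d j
        p = prev β (S β i d) j
        h = θ β i - θ β (d ∸ d)
        expand : ∀ s p h t → s - p - h * 0ℚ * t ≡ s - p
        expand = solve-∀ ℚ-ring

      S-truncate : ∀ β i j {m n} → m ℕ.≤′ n → (∀ {k} → m ℕ.< k → coef k j * τ β i k ≡ 0ℚ) →
        S β i n j ≡ S β i m j
      S-truncate β i j ℕ.≤′-refl _ = refl
      S-truncate β i j (ℕ.≤′-step m≤n) vanish =
        trans (cong₂ _+_ (S-truncate β i j m≤n vanish) (vanish (s≤s (ℕ.≤′⇒≤ m≤n)))) (+-identityʳ _)

      S-zero : ∀ β i → S β i d 0 ≡ 1ℚ
      S-zero β i = S-truncate β i 0 {n = d} ℕ.z≤′n λ { {suc k} _ → *-zeroˡ (τ β i (suc k)) }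

      -- Instead of evaluating the sum, the recurrence is read at j = 0, where c_1 = 1 and a_0 = 0.
      S-one : ∀ β i → 0 ℕ.< d → S β i d 1 ≡ θ β i
      S-one β i 0<d = begin
        S β i d 1                                    ≡⟨ *-identityˡ _ ⟨
        1ℚ * S β i d 1                               ≡⟨ cong (_* S β i d 1) c-one ⟨
        c 1 * S β i d 1                              ≡⟨ S-recurrence β i 0 0<d ⟩
        (θ β i - a β 0) * S β i d 0 - 0ℚ             ≡⟨ cong₂ (λ s t → (θ β i - s) * t - 0ℚ) (a-zero β) (S-zero β i) ⟩
        (θ β i - 0ℚ) * 1ℚ - 0ℚ                       ≡⟨ expand (θ β i) ⟩
        θ β i                                        ∎
        where
        open ≡-Reasoning
        expand : ∀ t → (t - 0ℚ) * 1ℚ - 0ℚ ≡ t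
        expand = solve-∀ ℚ-ring

      -- The coefficient of β ^ n in τ β i n, for e = d - i.
      T : ℕ → ℕ → ℚ
      T e zero    = 1ℚ
      T e (suc n) = (x e - x n) * 1/c n * T e n

      T-factor-positive : ∀ {e n} → n ℕ.< e → e ℕ.≤ d → 0ℚ < (x e - x n) * 1/c n
      T-factor-positive n<e e≤d =
        *-pos (p<q⇒0<q-p (x-mono-< n<e)) (÷₀-positive (c-positive (ℕ.<-≤-trans n<e e≤d)))

      T-positive : ∀ {e n} → n ℕ.≤ e → e ℕ.≤ d → 0ℚ < T e n
      T-positive {n = zero}  _   _   = positive⁻¹ 1ℚ
      T-positive {n = suc n} n<e e≤d =
        *-pos (T-factor-positive n<e e≤d) (T-positive (ℕ.<⇒≤ n<e) e≤d)

      -- For n ≤ e, `T e n` is a product of n positive factors, each strictly increasing in e. The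
      -- empty product does not grow, so strictness needs at least one factor.
      T-mono-≤ : ∀ {e f n} → e ℕ.< f → f ℕ.≤ d → n ℕ.≤ e → T e n ≤ T f n
      T-mono-< : ∀ {e f n} → e ℕ.< f → f ℕ.≤ d → n ℕ.< e → T e (suc n) < T f (suc n)

      T-mono-≤ {n = zero}  _   _   _   = ≤-refl
      T-mono-≤ {n = suc n} e<f f≤d n<e = <⇒≤ (T-mono-< e<f f≤d n<e)

      T-mono-< {e} {f} {n} e<f f≤d n<e = begin-strict
        (x e - x n) * 1/c n * T e n
          <⟨ *-monoˡ-<-pos (T e n) {{positive (T-positive (ℕ.<⇒≤ n<e) e≤d)}}
               (*-monoˡ-<-pos (1/c n) {{positive (÷₀-positive (c-positive (ℕ.<-≤-trans n<e e≤d)))}}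
                 (+-monoˡ-< (- x n) (x-mono-< e<f))) ⟩
        (x f - x n) * 1/c n * T e n
          ≤⟨ *-monoˡ-≤-nonNeg ((x f - x n) * 1/c n)
               {{nonNegative (<⇒≤ (T-factor-positive (ℕ.<-trans n<e e<f) f≤d))}}
               (T-mono-≤ e<f f≤d (ℕ.<⇒≤ n<e)) ⟩
        (x f - x n) * 1/c n * T f n ∎
        where
        open ≤-Reasoning
        e≤d : e ℕ.≤ d
        e≤d = ℕ.≤-trans (ℕ.<⇒≤ e<f) f≤d

      θ-reflect : ∀ β {n} → n ℕ.≤ d → θ β (d ∸ n) ≡ x n * (β - α * x (d ∸ n)) - x (d ∸ n)
      θ-reflect β {n} n≤d = cong (λ m → x m * (β - α * x (d ∸ n)) - x (d ∸ n)) (ℕ.m∸[m∸n]≡n n≤d)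

      τ-leading : ∀ i {n} → n ℕ.≤ d → Leading n (T (d ∸ i) n) (λ β → τ β i n)
      τ-leading i {zero}  _   = constant λ _ → refl
      τ-leading i {suc n} n<d = Leading-cong
        (λ β → trans (cong (λ t → (θ β i - t) * 1/c n * τ β i n) (θ-reflect β (ℕ.<⇒≤ n<d)))
          (expand (x (d ∸ i)) (x n) (x i) (x (d ∸ n)) (1/c n) α β (τ β i n)))
        (Leading-affine ((x (d ∸ i) - x n) * 1/c n) _ (τ-leading i (ℕ.<⇒≤ n<d)))
        where
        expand : ∀ e n i m r α β t →
          (e * (β - α * i) - i - (n * (β - α * m) - m)) * r * t
          ≡ ((e - n) * r * β + (n * α * m + m - e * α * i - i) * r) * t
        expand = solve-∀ ℚ-ring

      τ-vanishes : ∀ β {i n} → i ℕ.≤ d → d ∸ i ℕ.< n → τ β i n ≡ 0ℚ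
      τ-vanishes β {i} {suc n} i≤d (s≤s e≤n) with ℕ.m≤n⇒m<n∨m≡n e≤n
      ... | inj₁ e<n  = trans (cong ((θ β i - θ β (d ∸ n)) * 1/c n *_) (τ-vanishes β i≤d e<n))
        (*-zeroʳ ((θ β i - θ β (d ∸ n)) * 1/c n))
      ... | inj₂ refl = trans
        (cong (λ k → (θ β i - θ β k) * 1/c n * τ β i n) (ℕ.m∸[m∸n]≡n i≤d))
        (expand (θ β i) (1/c n) (τ β i n))
        where
        expand : ∀ s r t → (s - s) * r * t ≡ 0ℚ
        expand = solve-∀ ℚ-ring

      S-leading-≤ : ∀ i j {n} → n ℕ.≤ d → Leading n (coef n j * T (d ∸ i) n) (λ β → S β i n j)
      S-leading-≤ i j {zero}  _   = Leading-* (coef 0 j) (τ-leading i z≤n)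
      S-leading-≤ i j {suc n} n<d = subst (λ L → Leading (suc n) L (λ β → S β i (suc n) j))
        (+-identityˡ (coef (suc n) j * T (d ∸ i) (suc n)))
        (Leading-+ (Leading-raise (S-leading-≤ i j (ℕ.<⇒≤ n<d))) (Leading-* (coef (suc n) j) (τ-leading i n<d)))

      -- The alternatives are the two reasons why no summand beyond m survives: `coef k j` is zero
      -- for k > j, and τ_k is zero for k > d - i.
      S-leading : ∀ {i j m} → i ℕ.≤ d → m ℕ.≤ d → m ≡ j ⊎ m ≡ d ∸ i →
        Leading m (coef m j * T (d ∸ i) m) (λ β → S β i d j)
      S-leading {i} {j} {m} i≤d m≤d top = Leading-cong
        (λ β → S-truncate β i j (ℕ.≤⇒≤′ m≤d) (vanish β top)) (S-leading-≤ i j m≤d)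
        where
        vanish : ∀ β {k} → m ≡ j ⊎ m ≡ d ∸ i → m ℕ.< k → coef k j * τ β i k ≡ 0ℚ
        vanish β {k} (inj₁ refl) m<k = trans (cong (_* τ β i k) (shift-< {k} _ m<k)) (*-zeroˡ (τ β i k))
        vanish β {k} (inj₂ refl) m<k = trans (cong (coef k j *_) (τ-vanishes β i≤d m<k)) (*-zeroʳ (coef k j))

      leading-positive-low : ∀ i j → i ℕ.+ j ℕ.≤ d → 0ℚ < coef j j * T (d ∸ i) j
      leading-positive-low i j i+j≤d = *-pos (coef-diagonal-positive (ℕ.m+n≤o⇒n≤o i i+j≤d))
        (T-positive (ℕ.m+n≤o⇒m≤o∸n j (subst (ℕ._≤ d) (ℕ.+-comm i j) i+j≤d)) (ℕ.m∸n≤m d i))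

      leading-alternating-high : ∀ {i j} → i ℕ.≤ d → j ℕ.≤ d → d ℕ.≤ i ℕ.+ j →
        0ℚ < ε (i ℕ.+ j ∸ d) * (coef (d ∸ i) j * T (d ∸ i) (d ∸ i))
      leading-alternating-high {i} {j} i≤d j≤d d≤i+j = subst (0ℚ <_)
        (trans (*-assoc (ε k) (coef e (e ℕ.+ k)) (T e e)) (cong (λ l → ε k * (coef e l * T e e)) e+k≡j))
        (*-pos (coef-alternating e k (subst (ℕ._≤ d) (sym e+k≡j) j≤d)) (T-positive ℕ.≤-refl (ℕ.m∸n≤m d i)))
        where
        e = d ∸ i
        k = i ℕ.+ j ∸ d
        e+k≡j : e ℕ.+ k ≡ j
        e+k≡j = begin
          d ∸ i ℕ.+ (i ℕ.+ j ∸ d)     ≡⟨ ℕ.+-∸-comm (i ℕ.+ j ∸ d) i≤d ⟨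
          d ℕ.+ (i ℕ.+ j ∸ d) ∸ i     ≡⟨ cong (_∸ i) (ℕ.m+[n∸m]≡n d≤i+j) ⟩
          i ℕ.+ j ∸ i                 ≡⟨ ℕ.m+n∸m≡n i j ⟩
          j                           ∎
          where open ≡-Reasoning

      -- Truncated subtraction makes the sign factor 1 throughout i + j ≤ d, so both halves of (i)
      -- are one statement.
      S-alternating : ∀ {i j} → i ℕ.≤ d → j ℕ.≤ d →
        Eventually (λ β → 0ℚ < ε (i ℕ.+ j ∸ d) * S β i d j)
      S-alternating {i} {j} i≤d j≤d with ℕ.≤-total (i ℕ.+ j) d
      ... | inj₁ i+j≤d rewrite ℕ.m≤n⇒m∸n≡0 i+j≤d = Leading⇒positive
        (*-pos (positive⁻¹ 1ℚ) (leading-positive-low i j i+j≤d)) (Leading-* 1ℚ (S-leading i≤d j≤d (inj₁ refl)))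
      ... | inj₂ d≤i+j = Leading⇒positive (leading-alternating-high i≤d j≤d d≤i+j)
        (Leading-* (ε (i ℕ.+ j ∸ d)) (S-leading i≤d (ℕ.m∸n≤m d i) (inj₂ refl)))

      -- A sign s cannot make s * S β (suc i) d j dominate: either the degree in β drops
      -- from i to suc i, or it stays j and the leading coefficient gets smaller.
      S-dominates : ∀ {i j} s → (∀ {t u} → 0ℚ < u → u < t → 0ℚ < t + s * u) → i ℕ.< d → j ℕ.< d →
        Eventually (λ β → 0ℚ < ε (i ℕ.+ suc j ∸ d) * S β i d (suc j) + s * S β (suc i) d (suc j))
      S-dominates {i} {j} s dominate i<d j<d with ℕ.≤-<-connex (suc j) (d ∸ suc i)
      ... | inj₁ j<e = subst
        (λ k → Eventually (λ β → 0ℚ < ε k * S β i d (suc j) + s * S β (suc i) d (suc j)))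
        (sym (ℕ.m≤n⇒m∸n≡0 (ℕ.<⇒≤ suc-i+j≤d))) (Leading⇒positive
        (subst (λ t → 0ℚ < t + s * (g * T (d ∸ suc i) (suc j))) (sym (*-identityˡ (g * T (d ∸ i) (suc j))))
          (dominate (leading-positive-low (suc i) (suc j) suc-i+j≤d)
            (*-monoʳ-<-pos g {{positive (coef-diagonal-positive j<d)}}
              (T-mono-< (ℕ.∸-monoʳ-< (ℕ.n<1+n i) i<d) (ℕ.m∸n≤m d i) j<e))))
        (Leading-+ (Leading-* 1ℚ (S-leading (ℕ.<⇒≤ i<d) j<d (inj₁ refl)))
          (Leading-* s (S-leading i<d j<d (inj₁ refl)))))
        where
        g : ℚ
        g = coef (suc j) (suc j)
        suc-i+j≤d : suc i ℕ.+ suc j ℕ.≤ d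
        suc-i+j≤d = subst (ℕ._≤ d) (ℕ.+-comm (suc j) (suc i)) (ℕ.m≤o∸n⇒m+n≤o (suc j) i<d j<e)
      ... | inj₂ e≤j = Leading⇒positive
        (subst (0ℚ <_) (expand (ε k * L) s) (leading-alternating-high (ℕ.<⇒≤ i<d) j<d d≤i+j))
        (Leading-+ (Leading-* (ε k) (S-leading (ℕ.<⇒≤ i<d) (ℕ.m∸n≤m d i) (inj₂ refl)))
          -- Row `suc i` has degree at most d - i - 1. Regarded as having degree d - i it has
          -- leading coefficient 0, so it cannot affect the sign whatever s is.
          (Leading-* s (subst (λ m → Leading m 0ℚ (λ β → S β (suc i) d (suc j))) (sym d∸i≡)
            (Leading-raise (S-leading i<d (ℕ.m∸n≤m d (suc i)) (inj₂ refl))))))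
        where
        k = i ℕ.+ suc j ∸ d
        L = coef (d ∸ i) (suc j) * T (d ∸ i) (d ∸ i)
        d∸i≡ : d ∸ i ≡ suc (d ∸ suc i)
        d∸i≡ = ℕ.+-∸-assoc 1 i<d
        d≤i+j : d ℕ.≤ i ℕ.+ suc j
        d≤i+j = ℕ.≤-trans (ℕ.m≤n+m∸n d i) (ℕ.+-monoʳ-≤ i (subst (ℕ._≤ suc j) (sym d∸i≡) e≤j))
        expand : ∀ t s → t ≡ t + s * 0ℚ
        expand = solve-∀ ℚ-ring

      S-decreasing : ∀ {i j} → i ℕ.< d → j ℕ.< d →
        Eventually (λ β → ∣ S β (suc i) d (suc j) ∣ < ∣ S β i d (suc j) ∣)
      S-decreasing {i} {j} i<d j<d = Eventually-map (λ (sum , diff) → ∣∣<∣∣-ε (i ℕ.+ suc j ∸ d) sum diff)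
        (Eventually-× (S-dominates 1ℚ add i<d j<d) (S-dominates (- 1ℚ) subtract i<d j<d))
        where
        add : ∀ {t u} → 0ℚ < u → u < t → 0ℚ < t + 1ℚ * u
        add {t} {u} 0<u u<t = subst (λ v → 0ℚ < t + v) (sym (*-identityˡ u))
          (+-mono-< (<-trans 0<u u<t) 0<u)
        subtract : ∀ {t u} → 0ℚ < u → u < t → 0ℚ < t + (- 1ℚ) * u
        subtract {t} {u} _ u<t = subst (0ℚ <_) (expand t u) (p<q⇒0<q-p u<t)
          where
          expand : ∀ t u → t - u ≡ t + (- 1ℚ) * u
          expand = solve-∀ ℚ-ring

-- Large β

Signs Minima Decrease Conclusion : ℕ → ℤ → ℚ → ℚ → Set
Signs d b α β =
    (∀ i j → i ℕ.+ j ℕ.≤ d → 0ℚ < P i j)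
  × (∀ i j → i ℕ.≤ d → j ℕ.≤ d → d ℕ.≤ i ℕ.+ j → sgn (P i j) ≡ -1ℤ ℤ.^ (i ℕ.+ j ∸ d))
  where open Classical d b α β
Minima d b α β = ∀ j → 1 ℕ.≤ j → j ℕ.≤ d → IsMinimum (P (d ∸ j ℕ.+ 1) j) d (λ i → P i j)
  where open Classical d b α β
Decrease d b α β = ∀ i j → i ℕ.< d → 1 ℕ.≤ j → j ℕ.≤ d → ∣ P (i ℕ.+ 1) j ∣ < ∣ P i j ∣
  where open Classical d b α β
Conclusion d b α β = Signs d b α β × Minima d b α β × (1ℤ ℤ.≤ b → Decrease d b α β)

module _ {n d : ℕ} {b : ℤ} {α β : ℚ} {G : Graph n} (classical : HasClassicalParameters G d b α β) where
  open HasClassicalParameters classical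
  open Classical d b α β

  cᵢ-positive : ∀ {i} → i ℕ.< d → 0ℚ < cᵢ (suc i)
  cᵢ-positive {i} i<d = subst (0ℚ <_) (c#-classical (suc i) i<d) (<-≤-trans (positive⁻¹ 1ℚ)
    (fromℤ-mono-≤ (ℤ.+≤+ (c#-positive distanceRegular i<d))))

  aᵢ-nonNegative : ∀ {i} → i ℕ.< d → 0ℚ ≤ aᵢ (suc i)
  aᵢ-nonNegative {i} i<d = subst (0ℚ ≤_) (regroup (bᵢ 0) (bᵢ (suc i)) (cᵢ (suc i)))
    (subst (_≤ bᵢ 0 - (bᵢ (suc i) + cᵢ (suc i))) (+-inverseʳ (bᵢ (suc i) + cᵢ (suc i)))
      (+-monoˡ-≤ (- (bᵢ (suc i) + cᵢ (suc i))) bᵢ+cᵢ≤b₀))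
    where
    open ≤-Reasoning
    regroup : ∀ k s t → k - (s + t) ≡ k - s - t
    regroup = solve-∀ ℚ-ring
    bᵢ+cᵢ≤b₀ : bᵢ (suc i) + cᵢ (suc i) ≤ bᵢ 0
    bᵢ+cᵢ≤b₀ = begin
      bᵢ (suc i) + cᵢ (suc i)
        ≡⟨ cong₂ _+_ (b#-classical (suc i) i<d) (c#-classical (suc i) i<d) ⟨
      fromℕ (b# (suc i)) + fromℕ (c# (suc i))
        ≡⟨ fromℤ-+ (ℤ.+ b# (suc i)) (ℤ.+ c# (suc i)) ⟨
      fromℕ (b# (suc i) ℕ.+ c# (suc i))
        ≤⟨ fromℤ-mono-≤ (ℤ.+≤+ (b#+c#≤valency distanceRegular i<d)) ⟩
      fromℕ (b# 0)
        ≡⟨ b#-classical 0 z≤n ⟩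
      bᵢ 0 ∎

alternating⇒Signs : ∀ {d b α β} (let open Classical d b α β) →
  (∀ i → i ℕ.< suc d → ∀ j → j ℕ.< suc d → 0ℚ < ε (i ℕ.+ j ∸ d) * P i j) → Signs d b α β
alternating⇒Signs {d} {b} {α} {β} alternating =
  (λ i j i+j≤d → subst (0ℚ <_) (*-identityˡ (P i j))
    (subst (λ k → 0ℚ < ε k * P i j) (ℕ.m≤n⇒m∸n≡0 i+j≤d)
      (alternating i (s≤s (ℕ.m+n≤o⇒m≤o i i+j≤d)) j (s≤s (ℕ.m+n≤o⇒n≤o i i+j≤d))))) ,
  (λ i j i≤d j≤d _ → sgn-alternating (i ℕ.+ j ∸ d) (alternating i (s≤s i≤d) j (s≤s j≤d)))
  where open Classical d b α β

-- In column j the entries with i ≤ d - j are positive. Row d - j + 1 comes next: its entry is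
-- negative, and by the decrease no later entry exceeds it in absolute value.
Signs∧Decrease⇒Minima : ∀ {d b α β} (let open Classical d b α β) →
  (∀ i → i ℕ.< suc d → ∀ j → j ℕ.< suc d → 0ℚ < ε (i ℕ.+ j ∸ d) * P i j) →
  Decrease d b α β → Minima d b α β
Signs∧Decrease⇒Minima {d} {b} {α} {β} alternating decrease j 1≤j j≤d =
  (i₀ , i₀≤d , refl) , λ i i≤d → bound i i≤d (ℕ.≤-<-connex i (d ∸ j))
  where
  open Classical d b α β
  i₀ = d ∸ j ℕ.+ 1
  i₀≤d : i₀ ℕ.≤ d
  i₀≤d = ℕ.≤-trans (ℕ.+-monoʳ-≤ (d ∸ j) 1≤j) (ℕ.≤-reflexive (ℕ.m∸n+n≡m j≤d))
  i₀+j∸d : i₀ ℕ.+ j ∸ d ≡ 1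
  i₀+j∸d = begin
    d ∸ j ℕ.+ 1 ℕ.+ j ∸ d       ≡⟨ cong (_∸ d) (ℕ.+-assoc (d ∸ j) 1 j) ⟩
    d ∸ j ℕ.+ suc j ∸ d         ≡⟨ cong (_∸ d) (ℕ.+-suc (d ∸ j) j) ⟩
    suc (d ∸ j ℕ.+ j) ∸ d       ≡⟨ cong (λ m → suc m ∸ d) (ℕ.m∸n+n≡m j≤d) ⟩
    suc d ∸ d                   ≡⟨ ℕ.m+n∸n≡m 1 d ⟩
    1                           ∎
    where open ≡-Reasoning
  minimum-negative : 0ℚ < - P i₀ j
  minimum-negative = subst (0ℚ <_) (expand (P i₀ j))
    (subst (λ k → 0ℚ < ε k * P i₀ j) i₀+j∸d (alternating i₀ (s≤s i₀≤d) j (s≤s j≤d)))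
    where
    expand : ∀ p → (- 1ℚ) * p ≡ - p
    expand = solve-∀ ℚ-ring
  minimum-≡ : P i₀ j ≡ - ∣ P i₀ j ∣
  minimum-≡ = begin
    P i₀ j              ≡⟨ expand (P i₀ j) ⟩
    - (- P i₀ j)        ≡⟨ cong -_ (0≤p⇒∣p∣≡p (<⇒≤ minimum-negative)) ⟨
    - ∣ - P i₀ j ∣      ≡⟨ cong -_ (∣-p∣≡∣p∣ (P i₀ j)) ⟩
    - ∣ P i₀ j ∣        ∎
    where
    open ≡-Reasoning
    expand : ∀ p → p ≡ - - p
    expand = solve-∀ ℚ-ring
  ∣∣-antitone : ∀ {i k} → i ℕ.≤′ k → k ℕ.≤ d → ∣ P k j ∣ ≤ ∣ P i j ∣
  ∣∣-antitone ℕ.≤′-refl _ = ≤-refl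
  ∣∣-antitone (ℕ.≤′-step {k} i≤k) k<d = ≤-trans
    (<⇒≤ (subst (λ m → ∣ P m j ∣ < ∣ P k j ∣) (ℕ.+-comm k 1) (decrease k j k<d 1≤j j≤d)))
    (∣∣-antitone i≤k (ℕ.<⇒≤ k<d))
  bound : ∀ i → i ℕ.≤ d → i ℕ.≤ d ∸ j ⊎ d ∸ j ℕ.< i → P i₀ j ≤ P i j
  bound i i≤d (inj₁ i≤d∸j) = <⇒≤ (<-trans
    (subst₂ _<_ (sym (expand (P i₀ j))) refl (neg-antimono-< minimum-negative))
    (proj₁ (alternating⇒Signs {d} {b} {α} {β} alternating) i j (ℕ.m≤o∸n⇒m+n≤o i j≤d i≤d∸j)))
    where
    expand : ∀ p → p ≡ - - p
    expand = solve-∀ ℚ-ring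
  bound i i≤d (inj₂ i>d∸j) = begin
    P i₀ j              ≡⟨ minimum-≡ ⟩
    - ∣ P i₀ j ∣        ≤⟨ neg-antimono-≤ (∣∣-antitone (ℕ.≤⇒≤′ (subst (ℕ._≤ i) (ℕ.+-comm 1 (d ∸ j)) i>d∸j)) i≤d) ⟩
    - ∣ P i j ∣         ≤⟨ -∣p∣≤p (P i j) ⟩
    P i j               ∎
    where open ≤-Reasoning

-- Bases b ≥ 1

module _ (d : ℕ) (b : ℤ) (α : ℚ) (1≤b : 1ℤ ℤ.≤ b) where
  private
    [_] : ℕ → ℚ
    [ k ] = gauss b k 1ℤ

  0<fromℤ-b : 0ℚ < fromℤ b
  0<fromℤ-b = <-≤-trans (positive⁻¹ 1ℚ) (fromℤ-mono-≤ 1≤b)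

  open QIntegers (fromℤ b) 0<fromℤ-b [_] (gauss-zero b) (gauss-suc b)
  open Expansion d α

  module _ (c-positive : ∀ {n} → n ℕ.< d → 0ℚ < c (suc n)) where
    open Positive c-positive

    S≡P : ∀ β i j → j ℕ.≤ d → S β i d j ≡ Classical.P d b α β i j
    S≡P β i zero          _   = S-zero β i
    S≡P β i (suc zero)    0<d = S-one β i 0<d
    S≡P β i (suc (suc j)) j<d = step (S≡P β i (suc j) (ℕ.<⇒≤ j<d))
      (S≡P β i j (ℕ.≤-trans (ℕ.n≤1+n j) (ℕ.<⇒≤ j<d)))
      where
      step : S β i d (suc j) ≡ Classical.P d b α β i (suc j) → S β i d j ≡ Classical.P d b α β i j →
        S β i d (suc (suc j)) ≡ Classical.P d b α β i (suc (suc j))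
      step eq eq′ = sym (÷₀-unique {q = c (suc (suc j))} (pos⇒≢0 (c-positive j<d))
        (trans (S-recurrence β i (suc j) j<d)
          (cong₂ (λ s t → (θ β i - a β (suc j)) * s - bᵢ β j * t) eq eq′)))

    Alternating Decreasing : ℕ → ℕ → ℚ → Set
    Alternating i j β = 0ℚ < ε (i ℕ.+ j ∸ d) * Classical.P d b α β i j
    Decreasing i j β = ∣ Classical.P d b α β (suc i) (suc j) ∣ < ∣ Classical.P d b α β i (suc j) ∣

    P-alternating : ∀ i → i ℕ.< suc d → ∀ j → j ℕ.< suc d → Eventually (Alternating i j)
    P-alternating i (s≤s i≤d) j (s≤s j≤d) = Eventually-map {R = Alternating i j}
      (λ {β} → subst (λ t → 0ℚ < ε (i ℕ.+ j ∸ d) * t) (S≡P β i j j≤d)) (S-alternating i≤d j≤d)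

    P-decreasing : ∀ i → i ℕ.< d → ∀ j → j ℕ.< d → Eventually (Decreasing i j)
    P-decreasing i i<d j j<d = Eventually-map {R = Decreasing i j}
      (λ {β} → subst₂ (λ s t → ∣ s ∣ < ∣ t ∣) (S≡P β (suc i) (suc j) j<d) (S≡P β i (suc j) j<d))
      (S-decreasing i<d j<d)

    eventually-alternating : Eventually (λ β → ∀ i → i ℕ.< suc d → ∀ j → j ℕ.< suc d → Alternating i j β)
    eventually-alternating = Eventually-∀< {λ i β → ∀ j → j ℕ.< suc d → Alternating i j β} (suc d)
      λ i i≤d → Eventually-∀< {Alternating i} (suc d) (P-alternating i i≤d)

    eventually-decreasing : Eventually (λ β → ∀ i → i ℕ.< d → ∀ j → j ℕ.< d → Decreasing i j β)
    eventually-decreasing = Eventually-∀< {λ i β → ∀ j → j ℕ.< d → Decreasing i j β} d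
      λ i i<d → Eventually-∀< {Decreasing i} d (P-decreasing i i<d)

    eventually-Conclusion : Eventually (Conclusion d b α)
    eventually-Conclusion = Eventually-map (λ {β} → conclude {β})
      (Eventually-× eventually-alternating eventually-decreasing)
      where
      conclude : ∀ {β} (let open Classical d b α β) →
        (∀ i → i ℕ.< suc d → ∀ j → j ℕ.< suc d → 0ℚ < ε (i ℕ.+ j ∸ d) * P i j)
        × (∀ i → i ℕ.< d → ∀ j → j ℕ.< d → ∣ P (suc i) (suc j) ∣ < ∣ P i (suc j) ∣) →
        Conclusion d b α β
      conclude {β} (alternating , decreasing) =
        alternating⇒Signs {d} {b} {α} {β} alternating ,
        Signs∧Decrease⇒Minima {d} {b} {α} {β} alternating decrease , λ _ → decrease
        where
        open Classical d b α β
        decrease : Decrease d b α β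
        decrease i (suc j) i<d _ j<d =
          subst (λ m → ∣ P m (suc j) ∣ < ∣ P i (suc j) ∣) (ℕ.+-comm 1 i) (decreasing i i<d j j<d)

  -- The threshold must be fixed before a graph is given, yet the positivity of c_1, ..., c_d comes
  -- from a graph. These numbers do not depend on β, so their positivity is decided beforehand; if
  -- it fails, no graph exists for any β.
  positive-base : ∃[ β₀ ] ∀ β → β₀ ≤ β → (n : ℕ) (G : Graph n) → HasClassicalParameters G d b α β →
    Conclusion d b α β
  positive-base = decide (ℕ.allUpTo? (λ n → 0ℚ <? c (suc n)) d)
    where
    forGraphs : Eventually (Conclusion d b α) → ∃[ β₀ ] ∀ β → β₀ ≤ β → (n : ℕ) (G : Graph n) →
      HasClassicalParameters G d b α β → Conclusion d b α β
    forGraphs (β₀ , conclusion) = β₀ , λ β β₀≤β _ _ _ → conclusion β β₀≤β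
    decide : Dec (∀ {n} → n ℕ.< d → 0ℚ < c (suc n)) → ∃[ β₀ ] ∀ β → β₀ ≤ β → (n : ℕ) (G : Graph n) →
      HasClassicalParameters G d b α β → Conclusion d b α β
    decide (yes c-positive) = forGraphs (eventually-Conclusion (λ {n} → c-positive {n}))
    decide (no ¬c-positive) =
      0ℚ , λ _ _ _ _ classical → contradiction (λ {n} n<d → cᵢ-positive classical {n} n<d) ¬c-positive

-- Bases b ≤ -2

module _ (b : ℤ) (α : ℚ) (b≤-2 : b ℤ.≤ -[1+ 1 ]) where
  private
    [_] : ℕ → ℚ
    [ k ] = gauss b k 1ℤ

  [1]≡1 : [ 1 ] ≡ 1ℚ
  [1]≡1 = trans (gauss-suc b 0) (trans (cong (λ t → 1ℚ + fromℤ b * t) (gauss-zero b)) (expand (fromℤ b)))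
    where
    expand : ∀ q → 1ℚ + q * 0ℚ ≡ 1ℚ
    expand = solve-∀ ℚ-ring

  [2]≤-1 : [ 2 ] ≤ - 1ℚ
  [2]≤-1 = begin
    [ 2 ]                     ≡⟨ gauss-suc b 1 ⟩
    1ℚ + fromℤ b * [ 1 ]      ≡⟨ cong (λ t → 1ℚ + fromℤ b * t) [1]≡1 ⟩
    1ℚ + fromℤ b * 1ℚ         ≡⟨ cong (1ℚ +_) (*-identityʳ (fromℤ b)) ⟩
    1ℚ + fromℤ b              ≤⟨ +-monoʳ-≤ 1ℚ (fromℤ-mono-≤ b≤-2) ⟩
    - 1ℚ                      ∎
    where open ≤-Reasoning

  b≱1 : ¬ 1ℤ ℤ.≤ b
  b≱1 1≤b with ℤ.≤-trans 1≤b b≤-2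
  ... | ()

  -- Write a₂ = [2] β + K with K free of β. As [2] ≤ -1, this is at most - β + ∣ K ∣ for β ≥ 0, and
  -- the 1 added to ∣ K ∣ makes the inequality strict.
  a₂-negative : ∀ d → Eventually (λ β → Classical.aᵢ d b α β 2 < 0ℚ)
  a₂-negative d = ∣ K ∣ + 1ℚ , λ β β₀≤β → begin-strict
    Classical.aᵢ d b α β 2
      ≡⟨ cong (λ t → ([ d ] - t) * (β - α * t) - ([ d ] - [ 2 ]) * (β - α * [ 2 ]) - c₂) (gauss-zero b) ⟩
    ([ d ] - 0ℚ) * (β - α * 0ℚ) - ([ d ] - [ 2 ]) * (β - α * [ 2 ]) - c₂
      ≡⟨ expand [ d ] [ 2 ] α β c₂ ⟩
    [ 2 ] * β + K
      ≤⟨ +-monoˡ-≤ K (*-monoʳ-≤-nonNeg β {{nonNegative (0≤β β₀≤β)}} [2]≤-1) ⟩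
    (- 1ℚ) * β + K
      ≤⟨ +-monoʳ-≤ ((- 1ℚ) * β) (p≤∣p∣ K) ⟩
    (- 1ℚ) * β + ∣ K ∣
      <⟨ +-monoʳ-< ((- 1ℚ) * β) (<-≤-trans (∣K∣<β₀) β₀≤β) ⟩
    (- 1ℚ) * β + β
      ≡⟨ cancel β ⟩
    0ℚ ∎
    where
    open ≤-Reasoning
    c₂ = [ 2 ] * (1ℚ + α * [ 1 ])
    K = ([ d ] - [ 2 ]) * (α * [ 2 ]) - c₂
    ∣K∣<β₀ : ∣ K ∣ < ∣ K ∣ + 1ℚ
    ∣K∣<β₀ = subst (_< ∣ K ∣ + 1ℚ) (+-identityʳ ∣ K ∣) (+-monoʳ-< ∣ K ∣ (positive⁻¹ 1ℚ))
    0≤β : ∀ {β} → ∣ K ∣ + 1ℚ ≤ β → 0ℚ ≤ β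
    0≤β β₀≤β = ≤-trans (0≤∣p∣ K) (≤-trans (<⇒≤ ∣K∣<β₀) β₀≤β)
    expand : ∀ D t α β c →
      (D - 0ℚ) * (β - α * 0ℚ) - (D - t) * (β - α * t) - c ≡ t * β + ((D - t) * (α * t) - c)
    expand = solve-∀ ℚ-ring
    cancel : ∀ β → (- 1ℚ) * β + β ≡ 0ℚ
    cancel = solve-∀ ℚ-ring

  module _ (β : ℚ) where
    open Classical 1 b α β using (P)

    P₀₁≡β : P 0 1 ≡ β
    P₀₁≡β = trans (cong₂ (λ s t → s * (β - α * t) - t) [1]≡1 (gauss-zero b)) (expand α β)
      where
      expand : ∀ α β → 1ℚ * (β - α * 0ℚ) - 0ℚ ≡ β
      expand = solve-∀ ℚ-ring

    P₁₁≡-1 : P 1 1 ≡ - 1ℚ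
    P₁₁≡-1 = trans (cong₂ (λ s t → s * (β - α * t) - t) (gauss-zero b) [1]≡1) (expand α β)
      where
      expand : ∀ α β → 0ℚ * (β - α * 1ℚ) - 1ℚ ≡ - 1ℚ
      expand = solve-∀ ℚ-ring

  -- In diameter 1 the matrix has rows (1, β) and (1, -1), as for a complete graph of valency β, so
  -- positivity of β settles everything.
  negative-base-complete : ∀ β → 1ℚ ≤ β → Conclusion 1 b α β
  negative-base-complete β 1≤β = (low , high) , minimum , λ 1≤b → contradiction 1≤b b≱1
    where
    open Classical 1 b α β
    0<P₀₁ : 0ℚ < P 0 1
    0<P₀₁ = subst (0ℚ <_) (sym (P₀₁≡β β)) (<-≤-trans (positive⁻¹ 1ℚ) 1≤β)
    low : ∀ i j → i ℕ.+ j ℕ.≤ 1 → 0ℚ < P i j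
    low _       zero          _ = positive⁻¹ 1ℚ
    low zero    (suc zero)    _ = 0<P₀₁
    low zero    (suc (suc _)) (s≤s ())
    low (suc i) (suc j)       (s≤s h) = contradiction (subst (ℕ._≤ 0) (ℕ.+-suc i j) h) λ ()
    high : ∀ i j → i ℕ.≤ 1 → j ℕ.≤ 1 → 1 ℕ.≤ i ℕ.+ j → sgn (P i j) ≡ -1ℤ ℤ.^ (i ℕ.+ j ∸ 1)
    high zero       (suc zero) _ _ _ = sgn-positive 0<P₀₁
    high (suc zero) zero       _ _ _ = refl
    high (suc zero) (suc zero) _ _ _ = cong sgn (P₁₁≡-1 β)
    high (suc (suc _)) _ (s≤s ())
    high zero zero _ _ ()
    high _ (suc (suc _)) _ (s≤s ())
    minimum : Minima 1 b α β
    minimum (suc zero) _ _ = (1 , ℕ.≤-refl , refl) , bound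
      where
      bound : ∀ i → i ℕ.≤ 1 → P 1 1 ≤ P i 1
      bound zero          _ = <⇒≤ (<-trans (subst (_< 0ℚ) (sym (P₁₁≡-1 β)) (negative⁻¹ (- 1ℚ))) 0<P₀₁)
      bound (suc zero)    _ = ≤-refl
      bound (suc (suc _)) (s≤s ())
    minimum (suc (suc _)) _ (s≤s ())

  negative-base-empty : ∀ d → 2 ℕ.≤ d → Eventually (λ β → Classical.aᵢ d b α β 2 < 0ℚ) →
    ∃[ β₀ ] ∀ β → β₀ ≤ β → (n : ℕ) (G : Graph n) → HasClassicalParameters G d b α β → Conclusion d b α β
  negative-base-empty d 2≤d (β₀ , a₂<0) = β₀ , λ β β₀≤β _ _ classical →
    contradiction (≤-<-trans (aᵢ-nonNegative classical {1} 2≤d) (a₂<0 β β₀≤β)) (<-irrefl refl)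

  negative-base-point : ∀ β → Conclusion 0 b α β
  negative-base-point β =
    ((λ { zero zero _ → positive⁻¹ 1ℚ }) , λ { zero zero _ _ _ → refl }) , (λ { (suc _) _ () }) , λ _ _ _ ()

  negative-base : ∀ d → ∃[ β₀ ] ∀ β → β₀ ≤ β → (n : ℕ) (G : Graph n) →
    HasClassicalParameters G d b α β → Conclusion d b α β
  negative-base zero          = 0ℚ , λ β _ _ _ _ → negative-base-point β
  negative-base (suc zero)    = 1ℚ , λ β 1≤β _ _ _ → negative-base-complete β 1≤β
  negative-base (suc (suc d)) = negative-base-empty (suc (suc d)) (s≤s (s≤s z≤n)) (a₂-negative (suc (suc d)))

theorem4p5 : (d : ℕ) (b : ℤ) (α : ℚ) → b ≢ 0ℤ → b ≢ -1ℤ →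
    ∃[ β₀ ] ((β : ℚ) → β₀ ≤ β →
    (n : ℕ) (G : Graph n) → HasClassicalParameters G d b α β →
    let open Classical d b α β in
    ( (∀ i j → i ℕ.+ j ℕ.≤ d → 0ℚ < P i j)
    × (∀ i j → i ℕ.≤ d → j ℕ.≤ d → d ℕ.≤ i ℕ.+ j →
    sgn (P i j) ≡ -1ℤ ℤ.^ (i ℕ.+ j ∸ d)) )
    × (∀ j → 1 ℕ.≤ j → j ℕ.≤ d →
    IsMinimum (P (d ∸ j ℕ.+ 1) j) d (λ i → P i j))
    × (1ℤ ℤ.≤ b →
    ∀ i j → i ℕ.< d → 1 ℕ.≤ j → j ℕ.≤ d →
    ∣ P (i ℕ.+ 1) j ∣ < ∣ P i j ∣))
theorem4p5 d (ℤ.+ zero)      α b≢0 _    = contradiction refl b≢0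
theorem4p5 d b@(ℤ.+ suc _)   α _   _    = positive-base d b α (ℤ.+≤+ (s≤s z≤n))
theorem4p5 d -[1+ zero ]     α _   b≢-1 = contradiction refl b≢-1
theorem4p5 d b@(-[1+ suc _ ]) α _  _    = negative-base b α (ℤ.-≤- (s≤s z≤n)) d
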